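{- A connected graph $G$ with forest number $f(G)$ has $\mathrm{rc}(G) \leq f(G) + 2$.
   Context: For a connected, simple, finite graph $G$: an edge-coloring makes $G$ rainbow-connected if every pair of vertices is joined by a path with no two edges of the same color; $\mathrm{rc}(G)$ is the minimum number of colors needed to rainbow-connect $G$. The forest number $f(G)$ is the number of vertices in a largest induced forest of $G$. -}

module Defs where

open import Data.Nat using (ℕ; zero; suc; _≤_)
open import Data.Bool using (Bool; T; false)
open import Data.Fin using (Fin)
open import Data.Fin.Subset using (Subset; _∈_; ∣_∣)
open import Data.List using (List; []; _∷_; length)
open import Data.List.Relation.Unary.All using (All)
open import Data.List.Relation.Unary.Unique.Propositional using (Unique)
open import Data.Product using (Σ; ∃; _×_; Σ-syntax; ∃-syntax)
open import Relation.Binary.PropositionalEquality using (_≡_)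
open import Relation.Nullary using (¬_)

record Graph : Set where
  field
    n     : ℕ
    adj   : Fin n → Fin n → Bool
    sym   : ∀ u v → adj u v ≡ adj v u
    irrefl : ∀ u → adj u u ≡ false

module _ (G : Graph) where
  open Graph G

  Edge : Fin n → Fin n → Set
  Edge u v = T (adj u v)

  data Walk : Fin n → Fin n → Set where
    stop : ∀ {u} → Walk u u
    step : ∀ {u w v} → Edge u w → Walk w v → Walk u v

  vertices : ∀ {u v} → Walk u v → List (Fin n)
  vertices {u} stop = u ∷ []
  vertices {u} (step _ p) = u ∷ vertices p

  len : ∀ {u v} → Walk u v → ℕ
  len stop = 0
  len (step _ p) = suc (len p)

  IsPath : ∀ {u v} → Walk u v → Set
  IsPath p = Unique (vertices p)

  Connected : Set
  Connected = ∀ u v → Walk u v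

  -- an edge-coloring with k colors (colors of non-edges are irrelevant)
  record EdgeColoring (k : ℕ) : Set where
    field
      col     : Fin n → Fin n → Fin k
      col-sym : ∀ u v → col u v ≡ col v u

  edgeColors : ∀ {k} → EdgeColoring k → ∀ {u v} → Walk u v → List (Fin k)
  edgeColors c stop = []
  edgeColors c {u} (step {w = w} _ p) = EdgeColoring.col c u w ∷ edgeColors c p

  RainbowConnecting : ∀ {k} → EdgeColoring k → Set
  RainbowConnecting c = ∀ u v → Σ[ p ∈ Walk u v ] (IsPath p × Unique (edgeColors c p))

  RainbowConnectable : ℕ → Set
  RainbowConnectable k = Σ[ c ∈ EdgeColoring k ] RainbowConnecting c

  IsRc : ℕ → Set
  IsRc r = RainbowConnectable r × (∀ k → RainbowConnectable k → r ≤ k)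

  HasCycleIn : Subset n → Set
  HasCycleIn S = ∃[ u ] ∃[ w ] (Edge u w × Σ[ p ∈ Walk w u ]
                   (IsPath p × 2 ≤ len p × All (_∈ S) (vertices p)))

  InducedForest : Subset n → Set
  InducedForest S = ¬ HasCycleIn S

  IsForestNumber : ℕ → Set
  IsForestNumber f = (Σ[ S ∈ Subset n ] (InducedForest S × ∣ S ∣ ≡ f))
                   × (∀ S → InducedForest S → ∣ S ∣ ≤ f)

{-# OPTIONS --safe #-}
module Submission where

-- Fix a maximum induced forest F which, among those, has the most edges.  Every vertex outside F has two
-- neighbours in one component of F.  The vertices of F serve as colours, together with two extra colours,
-- and the rainbow connected set P grows by whole components of F along with all outside vertices having
-- two neighbours in them.  A vertex x of F is hung on P by an edge of the new colour x.  The last vertex ℓ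
-- of a component T is a leaf; its colour also hangs all outside vertices y on T − ℓ.  Two such vertices are
-- joined by colour ℓ, a path of T − ℓ and an extra colour, unless neither has a second neighbour in T − ℓ,
-- and then they are adjacent, for otherwise F − ℓ could be extended to a better forest.  If P reaches T only
-- through an outside vertex y, then T contains a path p₀ … pₘ between neighbours of y, and giving y p₀, y pₘ
-- and pₘ₋₁ pₘ the same colour saves a colour for the edge that joins y to P.  A vertex with two neighbours
-- in each of two components saves one more colour, which then plays the role of the colour of ℓ.

open import Defs
open import Data.Nat using (ℕ; _≤_; _+_)
import Algebra.Properties.CommutativeMonoid.Sum as Sums
open import Data.Bool using (Bool; true; false; T; _∧_; _∨_; not; if_then_else_)
import Data.Bool.Properties as Bool
open import Data.Empty using (⊥; ⊥-elim)
open import Data.Fin using (Fin; zero; suc)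
import Data.Fin as Fin⁺
import Data.Fin.Properties as Fin
open import Data.Fin.Subset using (∣_∣)
open import Data.List using ([]; _∷_)
import Data.List.Membership.DecPropositional as DecMembership
open import Data.List.Membership.Propositional using () renaming (_∈_ to _∈ᴸ_)
open import Data.List.Relation.Unary.All using (All; []; _∷_)
import Data.List.Relation.Unary.All as All
open import Data.List.Relation.Unary.AllPairs using ([]; _∷_)
import Data.List.Relation.Unary.AllPairs as AllPairs
open import Data.List.Relation.Unary.Any using (here; there)
open import Data.List.Relation.Unary.Unique.Propositional using (Unique)
open import Data.Nat using (zero; suc; _<_; _*_; z≤n; s≤s)
import Data.Nat.Properties as ℕ
open import Data.Product using (Σ-syntax; ∃-syntax; _×_; _,_; proj₁; proj₂)
open import Data.Sum using (_⊎_; inj₁; inj₂)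
import Data.Sum as Sum
open import Data.Sum.Properties using (inj₁-injective)
open import Data.Unit using (⊤; tt)
open import Data.Vec using (lookup; tabulate)
import Data.Vec.Properties as Vec
open import Function using (_∘_; id)
open import Relation.Binary.PropositionalEquality
open import Relation.Nullary using (¬_; Dec; yes; no; does)
open import Relation.Nullary.Decidable using (dec-true; dec-false; decidable-stable)
open Sums ℕ.+-0-commutativeMonoid using (sum; sum-cong-≗; ∑-distrib-+)

-- Two extra colours serve all components: an extra colour occurs only where a walk links two
-- vertices hung in the same step, and such a link stays inside the part `C` built since the current
-- component was entered. `C` restarts as a single vertex, so both extra colours are unspent in it
-- again. Both are needed in one component when a vertex y has two neighbours in each of two
-- components: one colour links ℓ to y, the other links the outside vertices hung at the end.
-- Maximality of the edge number is what controls the other components. Two non-adjacent vertices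
-- that may each replace ℓ could still close a cycle together through components far from T; density
-- leaves each of them one neighbour in F - ℓ, which excludes this. The forest does not stay fixed.
-- If the path p₀ ... pₘ is all of T, every name of T is spent and none is left to hang the outside
-- vertices. Then y replaces p₀: the new forest is again extremal, P now touches its new component
-- directly in y, and the names in use survive because no placed vertex leaves the forest.

-- Walks, loop erasure, and cycles through an added vertex

module Walks (G : Graph) where
  open Graph G using (n; adj; irrefl) renaming (sym to adj-sym)

  V : Set
  V = Fin n

  infix 4 _~_
  _~_ : V → V → Set
  u ~ v = Edge G u v

  ~-sym : ∀ {u v} → u ~ v → v ~ u
  ~-sym {u} {v} = subst T (adj-sym u v)

  ~⇒≢ : ∀ {u v} → u ~ v → u ≢ v
  ~⇒≢ {u} e refl = subst T (irrefl u) e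

  data Reach (S : V → Set) : V → V → Set where
    here : ∀ {u} → S u → Reach S u u
    step : ∀ {u w v} → S u → u ~ w → Reach S w v → Reach S u v

  module _ {S : V → Set} where
    source : ∀ {u v} → Reach S u v → S u
    source (here s) = s
    source (step s _ _) = s

    target : ∀ {u v} → Reach S u v → S v
    target (here s) = s
    target (step _ _ p) = target p

    infixr 5 _◅◅_
    _◅◅_ : ∀ {u v w} → Reach S u v → Reach S v w → Reach S u w
    here _ ◅◅ q = q
    step s e p ◅◅ q = step s e (p ◅◅ q)

    reach-sym : ∀ {u v} → Reach S u v → Reach S v u
    reach-sym (here s) = here s
    reach-sym (step s e p) = reach-sym p ◅◅ step (source p) (~-sym e) (here s)

    reach⇒walk : ∀ {u v} → Reach S u v → Σ[ p ∈ Walk G u v ] All S (vertices G p)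
    reach⇒walk (here s) = stop , s ∷ []
    reach⇒walk (step s e p) = let q , a = reach⇒walk p in step e q , s ∷ a

    walk⇒reach : ∀ {u v} (p : Walk G u v) → All S (vertices G p) → Reach S u v
    walk⇒reach stop (s ∷ []) = here s
    walk⇒reach (step e p) (s ∷ a) = step s e (walk⇒reach p a)

  reach-mono : ∀ {S S′ : V → Set} → (∀ {x} → S x → S′ x) → ∀ {u v} → Reach S u v → Reach S′ u v
  reach-mono f (here s) = here (f s)
  reach-mono f (step s e p) = step (f s) e (reach-mono f p)

  head∈ : ∀ {u v} (p : Walk G u v) → u ∈ᴸ vertices G p
  head∈ stop = here refl
  head∈ (step _ _) = here refl

  last∈ : ∀ {u v} (p : Walk G u v) → v ∈ᴸ vertices G p
  last∈ stop = here refl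
  last∈ (step _ p) = there (last∈ p)

  reach-vertex : ∀ {u v x} (p : Walk G u v) → x ∈ᴸ vertices G p → Reach (_∈ᴸ vertices G p) u x
  reach-vertex stop (here refl) = here (here refl)
  reach-vertex (step e p) (here refl) = here (here refl)
  reach-vertex (step e p) (there m) = step (here refl) e (reach-mono there (reach-vertex p m))

  dropTo : ∀ {u v x} (p : Walk G u v) → x ∈ᴸ vertices G p → Walk G x v
  dropTo stop (here refl) = stop
  dropTo (step e p) (here refl) = step e p
  dropTo (step e p) (there m) = dropTo p m

  dropTo-path : ∀ {u v x} (p : Walk G u v) (m : x ∈ᴸ vertices G p) → IsPath G p → IsPath G (dropTo p m)
  dropTo-path stop (here refl) a = a
  dropTo-path (step e p) (here refl) a = a
  dropTo-path (step e p) (there m) (_ ∷ a) = dropTo-path p m a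

  dropTo-All : ∀ {S : V → Set} {u v x} (p : Walk G u v) (m : x ∈ᴸ vertices G p) →
               All S (vertices G p) → All S (vertices G (dropTo p m))
  dropTo-All stop (here refl) a = a
  dropTo-All (step e p) (here refl) a = a
  dropTo-All (step e p) (there m) (_ ∷ a) = dropTo-All p m a

  dropTo-colors : ∀ {k} (c : EdgeColoring G k) {Q : Fin k → Set} {u v x} (p : Walk G u v) (m : x ∈ᴸ vertices G p) →
                  All Q (edgeColors G c p) → All Q (edgeColors G c (dropTo p m))
  dropTo-colors c stop (here refl) a = a
  dropTo-colors c (step e p) (here refl) a = a
  dropTo-colors c (step e p) (there m) (_ ∷ a) = dropTo-colors c p m a

  dropTo-rainbow : ∀ {k} (c : EdgeColoring G k) {u v x} (p : Walk G u v) (m : x ∈ᴸ vertices G p) →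
                   Unique (edgeColors G c p) → Unique (edgeColors G c (dropTo p m))
  dropTo-rainbow c stop (here refl) a = a
  dropTo-rainbow c (step e p) (here refl) a = a
  dropTo-rainbow c (step e p) (there m) (_ ∷ a) = dropTo-rainbow c p m a

  open DecMembership (Fin._≟_ {n}) using () renaming (_∈?_ to _∈ᴸ?_)

  cons-erase : ∀ {u w v} → u ~ w → Walk G w v → Walk G u v
  cons-erase {u} e q with u ∈ᴸ? vertices G q
  ... | yes m = dropTo q m
  ... | no _ = step e q

  erase : ∀ {u v} → Walk G u v → Walk G u v
  erase stop = stop
  erase (step e p) = cons-erase e (erase p)

  ∉⇒All≢ : ∀ {x : V} {xs} → ¬ x ∈ᴸ xs → All (x ≢_) xs
  ∉⇒All≢ {xs = []} _ = []
  ∉⇒All≢ {xs = y ∷ ys} m = (λ e → m (here e)) ∷ ∉⇒All≢ (λ k → m (there k))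

  erase-path : ∀ {u v} (p : Walk G u v) → IsPath G (erase p)
  erase-path stop = [] ∷ []
  erase-path {u} (step e p) with u ∈ᴸ? vertices G (erase p)
  ... | yes m = dropTo-path (erase p) m (erase-path p)
  ... | no m = ∉⇒All≢ m ∷ erase-path p

  erase-All : ∀ {S : V → Set} {u v} (p : Walk G u v) → All S (vertices G p) → All S (vertices G (erase p))
  erase-All stop a = a
  erase-All {u = u} (step e p) (s ∷ a) with u ∈ᴸ? vertices G (erase p)
  ... | yes m = dropTo-All (erase p) m (erase-All p a)
  ... | no _ = s ∷ erase-All p a

  erase-colors : ∀ {k} (c : EdgeColoring G k) {Q : Fin k → Set} {u v} (p : Walk G u v) →
                 All Q (edgeColors G c p) → All Q (edgeColors G c (erase p))
  erase-colors c stop a = a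
  erase-colors c {u = u} (step e p) (q ∷ a) with u ∈ᴸ? vertices G (erase p)
  ... | yes m = dropTo-colors c (erase p) m (erase-colors c p a)
  ... | no _ = q ∷ erase-colors c p a

  erase-rainbow : ∀ {k} (c : EdgeColoring G k) {u v} (p : Walk G u v) →
                  Unique (edgeColors G c p) → Unique (edgeColors G c (erase p))
  erase-rainbow c stop a = a
  erase-rainbow c {u} (step e p) (q ∷ a) with u ∈ᴸ? vertices G (erase p)
  ... | yes m = dropTo-rainbow c (erase p) m (erase-rainbow c p a)
  ... | no _ = erase-colors c p q ∷ erase-rainbow c p a

  reach⇒path : ∀ {S : V → Set} {u v} → Reach S u v → Σ[ p ∈ Walk G u v ] IsPath G p × All S (vertices G p)
  reach⇒path r = let p , a = reach⇒walk r in erase p , erase-path p , erase-All p a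

  Cyclic : (V → Set) → Set
  Cyclic S = ∃[ u ] ∃[ w ] (Edge G u w × Σ[ p ∈ Walk G w u ] (IsPath G p × 2 ≤ len G p × All S (vertices G p)))

  -- For y outside a forest S this is exactly the obstruction to adding y.
  Double : (V → Set) → V → Set
  Double S y = ∃[ a ] ∃[ b ] (a ≢ b × y ~ a × y ~ b × Reach S a b)

  closed-path : ∀ {u} (p : Walk G u u) → IsPath G p → len G p ≡ 0
  closed-path stop _ = refl
  closed-path (step e p) (a ∷ _) = ⊥-elim (All.lookup a (last∈ p) refl)

  double⇒cyclic : ∀ {S : V → Set} {x} → S x → Double (λ v → S v × x ≢ v) x → Cyclic S
  double⇒cyclic {S} {x} s (a , b , a≢b , xa , xb , r) with reach⇒path r
  ... | p , pp , all = b , x , ~-sym xb , step xa p , (All.map proj₂ all ∷ pp) , s≤s (pos p) , s ∷ All.map proj₁ all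
    where pos : (p : Walk G a b) → 1 ≤ len G p
          pos stop = ⊥-elim (a≢b refl)
          pos (step _ _) = s≤s z≤n

  -- `after≢` and `len≡` serve to show that the two cycle neighbours of y are distinct: the former
  -- when y is an inner vertex, the latter when y is the last one.
  record SplitAt (y : V) {w u : V} (p : Walk G w u) : Set where
    field
      {z}         : V
      before      : Walk G w z
      edge        : z ~ y
      after       : Walk G y u
      before-path : IsPath G before
      after-path  : IsPath G after
      before≢     : ¬ y ∈ᴸ vertices G before
      after≢      : ¬ z ∈ᴸ vertices G after
      before⊆     : ∀ {x} → x ∈ᴸ vertices G before → x ∈ᴸ vertices G p
      after⊆      : ∀ {x} → x ∈ᴸ vertices G after → x ∈ᴸ vertices G p
      len≡        : len G p ≡ len G before + suc (len G after)

  splitAt : ∀ {y w u} (p : Walk G w u) → IsPath G p → y ∈ᴸ vertices G p → w ≢ y → SplitAt y p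
  splitAt stop _ (here refl) w≢y = ⊥-elim (w≢y refl)
  splitAt (step e p) _ (here refl) w≢y = ⊥-elim (w≢y refl)
  splitAt {y} {w} (step {w = x} e p) (a ∷ pp) (there m) w≢y with x Fin.≟ y
  ... | yes refl = record
    { before = stop ; edge = e ; after = p ; before-path = [] ∷ [] ; after-path = pp
    ; before≢ = λ { (here eq) → w≢y (sym eq) } ; after≢ = λ k → All.lookup a k refl
    ; before⊆ = λ { (here eq) → here eq } ; after⊆ = there ; len≡ = refl }
  ... | no x≢y = record
    { before = step e before ; edge = edge ; after = after
    ; before-path = All.tabulate (λ k → All.lookup a (before⊆ k)) ∷ before-path ; after-path = after-path
    ; before≢ = λ { (here eq) → w≢y (sym eq) ; (there k) → before≢ k } ; after≢ = after≢
    ; before⊆ = λ { (here eq) → here eq ; (there k) → there (before⊆ k) }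
    ; after⊆ = λ k → there (after⊆ k) ; len≡ = cong suc len≡ }
    where open SplitAt (splitAt p pp m x≢y)

  -- A cycle through y enters and leaves it by two different neighbours, and the rest of the cycle
  -- joins these in S. The cases are y at the start, at the end or in the interior of the path that
  -- the closing edge `uw` completes.
  acyclic-insert : ∀ {S : V → Set} {y} → ¬ Cyclic S → ¬ Double S y → ¬ Cyclic (λ v → S v ⊎ v ≡ y)
  acyclic-insert {S} {y} acyclic single (u , w , uw , p , pp , 2≤ , all) = main
    where
    inS : ∀ {x} → x ∈ᴸ vertices G p → x ≢ y → S x
    inS m x≢y with All.lookup all m
    ... | inj₁ s = s
    ... | inj₂ eq = ⊥-elim (x≢y eq)

    fromStart : (p : Walk G y u) → IsPath G p → 2 ≤ len G p → (∀ {x} → x ∈ᴸ vertices G p → x ≢ y → S x) → u ~ y → ⊥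
    fromStart (step {w = x} e q) (a ∷ qp) (s≤s 1≤) inS uy =
      single (x , u , x≢u , e , ~-sym uy ,
              walk⇒reach q (All.tabulate (λ k → inS (there k) (λ eq → All.lookup a k (sym eq)))))
      where
      x≢u : x ≢ u
      x≢u refl with subst (1 ≤_) (closed-path q qp) 1≤
      ... | ()

    through : SplitAt y p → ⊥
    through sp = go after refl after-path after≢ after⊆ len≡
      where
      open SplitAt sp
      w⇝z : Reach S w z
      w⇝z = walk⇒reach before (All.tabulate λ k → inS (before⊆ k) (λ { refl → before≢ k }))
      go : ∀ {u′} (q : Walk G y u′) → u′ ≡ u → IsPath G q → ¬ z ∈ᴸ vertices G q →
           (∀ {x} → x ∈ᴸ vertices G q → x ∈ᴸ vertices G p) → len G p ≡ len G before + suc (len G q) → ⊥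
      go stop refl _ _ _ eq = single (w , z , w≢z eq , uw , ~-sym edge , w⇝z)
        where
        w≢z : len G p ≡ len G before + 1 → w ≢ z
        w≢z eq refl with subst (2 ≤_) (trans eq (cong (_+ 1) (closed-path before before-path))) 2≤
        ... | s≤s ()
      go (step {w = x} e q) refl (a ∷ _) z∉ ⊆p _ =
        single (x , z , (λ { refl → z∉ (there (head∈ q)) }) , e , ~-sym edge , x⇝u ◅◅ step (target x⇝u) uw w⇝z)
        where
        x⇝u : Reach S x u
        x⇝u = walk⇒reach q (All.tabulate λ k → inS (⊆p (there k)) (λ eq → All.lookup a k (sym eq)))

    main : ⊥
    main with y ∈ᴸ? vertices G p
    ... | no m = acyclic (u , w , uw , p , pp , 2≤ , All.tabulate (λ k → inS k (λ { refl → m k })))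
    ... | yes m with w Fin.≟ y
    ...   | yes refl = fromStart p pp 2≤ inS uw
    ...   | no w≢y = through (splitAt p pp m w≢y)

-- Counting with characteristic functions

𝟙 : Bool → ℕ
𝟙 true = 1
𝟙 false = 0

_==_ : ∀ {n} → Fin n → Fin n → Bool
i == j = does (i Fin.≟ j)

==-refl : ∀ {n} (i : Fin n) → (i == i) ≡ true
==-refl i = dec-true (i Fin.≟ i) refl

==-true : ∀ {n} {i j : Fin n} → (i == j) ≡ true → i ≡ j
==-true {i = i} {j} eq with i Fin.≟ j
... | yes p = p

==-false : ∀ {n} {i j : Fin n} → i ≢ j → (i == j) ≡ false
==-false {i = i} {j} = dec-false (i Fin.≟ j)

insert delete : ∀ {n} → (Fin n → Bool) → Fin n → Fin n → Bool
insert S x v = S v ∨ (v == x)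
delete S x v = S v ∧ not (v == x)

sum-zero : ∀ {n} (g : Fin n → ℕ) → (∀ i → g i ≡ 0) → sum g ≡ 0
sum-zero {zero} g z = refl
sum-zero {suc n} g z = cong₂ _+_ (z zero) (sum-zero (g ∘ suc) (z ∘ suc))

sum-at : ∀ {n} (x : Fin n) (g : Fin n → ℕ) → sum (λ v → 𝟙 (v == x) * g v) ≡ g x
sum-at {suc n} zero g = trans (cong₂ _+_ (ℕ.+-identityʳ (g zero)) (sum-zero {n} (λ _ → 0) (λ _ → refl))) (ℕ.+-identityʳ (g zero))
sum-at (suc x) g = sum-at x (g ∘ suc)

count : ∀ {n} → (Fin n → Bool) → ℕ
count S = sum (𝟙 ∘ S)

count-cong : ∀ {n} {S S′ : Fin n → Bool} → (∀ v → S v ≡ S′ v) → count S ≡ count S′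
count-cong eq = sum-cong-≗ (cong 𝟙 ∘ eq)

∣tabulate∣ : ∀ {n} (S : Fin n → Bool) → ∣ tabulate S ∣ ≡ count S
∣tabulate∣ {zero} S = refl
∣tabulate∣ {suc n} S with S zero
... | true = cong suc (∣tabulate∣ (S ∘ suc))
... | false = ∣tabulate∣ (S ∘ suc)

𝟙-insert : ∀ {n} (S : Fin n → Bool) {x} → S x ≡ false → ∀ v → 𝟙 (insert S x v) ≡ 𝟙 (S v) + 𝟙 (v == x)
𝟙-insert S {x} s v with v Fin.≟ x
... | yes refl rewrite s = refl
... | no _ rewrite Bool.∨-identityʳ (S v) = sym (ℕ.+-identityʳ _)

insert-delete : ∀ {n} (S : Fin n → Bool) {x} → S x ≡ true → ∀ v → S v ≡ insert (delete S x) x v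
insert-delete S {x} s v with v Fin.≟ x
... | yes refl rewrite s = refl
... | no _ = sym (trans (Bool.∨-identityʳ _) (Bool.∧-identityʳ _))

delete-self : ∀ {n} (S : Fin n → Bool) x → delete S x x ≡ false
delete-self S x rewrite ==-refl x = Bool.∧-zeroʳ (S x)

count-insert : ∀ {n} (S : Fin n → Bool) {x} → S x ≡ false → count (insert S x) ≡ suc (count S)
count-insert S {x} s = begin
  sum (𝟙 ∘ insert S x)                       ≡⟨ sum-cong-≗ (𝟙-insert S s) ⟩
  sum (λ v → 𝟙 (S v) + 𝟙 (v == x))           ≡⟨ ∑-distrib-+ (𝟙 ∘ S) (λ v → 𝟙 (v == x)) ⟩
  count S + sum (λ v → 𝟙 (v == x))           ≡⟨ cong (count S +_) (sum-cong-≗ λ v → sym (ℕ.*-identityʳ (𝟙 (v == x)))) ⟩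
  count S + sum (λ v → 𝟙 (v == x) * 1)       ≡⟨ cong (count S +_) (sum-at x (λ _ → 1)) ⟩
  count S + 1                                ≡⟨ ℕ.+-comm (count S) 1 ⟩
  suc (count S)                              ∎
  where open ≡-Reasoning

count-delete : ∀ {n} (S : Fin n → Bool) {x} → S x ≡ true → count S ≡ suc (count (delete S x))
count-delete S {x} s = trans (count-cong (insert-delete S s)) (count-insert (delete S x) (delete-self S x))

count≥1 : ∀ {n} (S : Fin n → Bool) {x} → S x ≡ true → 1 ≤ count S
count≥1 S s = subst (1 ≤_) (sym (count-delete S s)) (s≤s z≤n)

delete-other : ∀ {n} (S : Fin n → Bool) {x y} → S y ≡ true → y ≢ x → delete S x y ≡ true
delete-other S s y≢x rewrite s | ==-false y≢x = refl

count≥2 : ∀ {n} (S : Fin n → Bool) {x y} → S x ≡ true → S y ≡ true → x ≢ y → 2 ≤ count S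
count≥2 S {x} s s′ x≢y =
  subst (2 ≤_) (sym (count-delete S s)) (s≤s (count≥1 (delete S x) (delete-other S s′ (x≢y ∘ sym))))

count≤1 : ∀ {n} (S : Fin n → Bool) → (∀ {a b} → S a ≡ true → S b ≡ true → a ≡ b) → count S ≤ 1
count≤1 {zero} S _ = z≤n
count≤1 {suc n} S one with S zero in eq
... | false = count≤1 (S ∘ suc) (λ p q → Fin.suc-injective (one p q))
... | true = s≤s (ℕ.≤-reflexive (sum-zero _ (λ i → rest i (S (suc i)) refl)))
  where
  rest : ∀ i b → S (suc i) ≡ b → 𝟙 b ≡ 0
  rest i false _ = refl
  rest i true p with one p eq
  ... | ()

𝟙-mono : ∀ a b → (a ≡ true → b ≡ true) → 𝟙 a ≤ 𝟙 b
𝟙-mono false b _ = z≤n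
𝟙-mono true b f rewrite f refl = s≤s z≤n

count-mono : ∀ {n} (S S′ : Fin n → Bool) → (∀ v → S v ≡ true → S′ v ≡ true) → count S ≤ count S′
count-mono {zero} S S′ sub = z≤n
count-mono {suc n} S S′ sub = ℕ.+-mono-≤ (𝟙-mono (S zero) (S′ zero) (sub zero)) (count-mono _ _ (sub ∘ suc))

count-mono-< : ∀ {n} (S S′ : Fin n → Bool) {x} → (∀ v → S v ≡ true → S′ v ≡ true) →
               S x ≡ false → S′ x ≡ true → count S < count S′
count-mono-< S S′ {zero} sub s s′ rewrite s | s′ = s≤s (count-mono (S ∘ suc) (S′ ∘ suc) (sub ∘ suc))
count-mono-< S S′ {suc x} sub s s′ =
  ℕ.+-mono-≤-< (𝟙-mono (S zero) (S′ zero) (sub zero)) (count-mono-< (S ∘ suc) (S′ ∘ suc) (sub ∘ suc) s s′)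

-- Degrees and edge numbers of induced subgraphs

module Degrees (G : Graph) where
  open Graph G using (n; adj; irrefl) renaming (sym to adj-sym)
  open Walks G

  nbrs : (V → Bool) → V → V → Bool
  nbrs S x v = S v ∧ adj x v

  deg : (V → Bool) → V → ℕ
  deg S x = count (nbrs S x)

  -- counts every edge of the induced subgraph twice
  edges : (V → Bool) → ℕ
  edges S = sum (λ u → 𝟙 (S u) * deg S u)

  edges-cong : ∀ {S S′ : V → Bool} → (∀ v → S v ≡ S′ v) → edges S ≡ edges S′
  edges-cong eq = sum-cong-≗ λ u → cong₂ _*_ (cong 𝟙 (eq u)) (count-cong λ v → cong (_∧ adj u v) (eq v))

  private
    𝟙-∧ : ∀ a b → 𝟙 (a ∧ b) ≡ 𝟙 a * 𝟙 b
    𝟙-∧ true b = sym (ℕ.+-identityʳ (𝟙 b))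
    𝟙-∧ false b = refl

  deg-insert : ∀ (S : V → Bool) {x} → S x ≡ false → ∀ u → deg (insert S x) u ≡ deg S u + 𝟙 (adj u x)
  deg-insert S {x} s u = begin
    sum (λ v → 𝟙 (insert S x v ∧ adj u v))
      ≡⟨ sum-cong-≗ (λ v → trans (𝟙-∧ (insert S x v) (adj u v)) (trans (cong (_* 𝟙 (adj u v)) (𝟙-insert S s v))
           (trans (ℕ.*-distribʳ-+ (𝟙 (adj u v)) (𝟙 (S v)) (𝟙 (v == x))) (cong (_+ _) (sym (𝟙-∧ (S v) (adj u v))))))) ⟩
    sum (λ v → 𝟙 (S v ∧ adj u v) + 𝟙 (v == x) * 𝟙 (adj u v))
      ≡⟨ ∑-distrib-+ (λ v → 𝟙 (S v ∧ adj u v)) (λ v → 𝟙 (v == x) * 𝟙 (adj u v)) ⟩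
    deg S u + sum (λ v → 𝟙 (v == x) * 𝟙 (adj u v))
      ≡⟨ cong (deg S u +_) (sum-at x (𝟙 ∘ adj u)) ⟩
    deg S u + 𝟙 (adj u x) ∎
    where open ≡-Reasoning

  edges-insert : ∀ (S : V → Bool) {x} → S x ≡ false → edges (insert S x) ≡ edges S + (deg S x + deg S x)
  edges-insert S {x} s = begin
    sum (λ u → 𝟙 (insert S x u) * deg (insert S x) u)
      ≡⟨ sum-cong-≗ expand ⟩
    sum (λ u → (𝟙 (S u) * deg S u + 𝟙 (nbrs S x u)) + 𝟙 (u == x) * (deg S u + 𝟙 (adj u x)))
      ≡⟨ ∑-distrib-+ (λ u → 𝟙 (S u) * deg S u + 𝟙 (nbrs S x u)) _ ⟩
    sum (λ u → 𝟙 (S u) * deg S u + 𝟙 (nbrs S x u)) + sum (λ u → 𝟙 (u == x) * (deg S u + 𝟙 (adj u x)))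
      ≡⟨ cong₂ _+_ (∑-distrib-+ (λ u → 𝟙 (S u) * deg S u) (𝟙 ∘ nbrs S x)) (sum-at x (λ u → deg S u + 𝟙 (adj u x))) ⟩
    (edges S + deg S x) + (deg S x + 𝟙 (adj x x))
      ≡⟨ cong (λ b → (edges S + deg S x) + (deg S x + 𝟙 b)) (irrefl x) ⟩
    (edges S + deg S x) + (deg S x + 0)
      ≡⟨ cong ((edges S + deg S x) +_) (ℕ.+-identityʳ _) ⟩
    (edges S + deg S x) + deg S x
      ≡⟨ ℕ.+-assoc (edges S) _ _ ⟩
    edges S + (deg S x + deg S x) ∎
    where
    open ≡-Reasoning
    expand : ∀ u → 𝟙 (insert S x u) * deg (insert S x) u ≡
                   (𝟙 (S u) * deg S u + 𝟙 (nbrs S x u)) + 𝟙 (u == x) * (deg S u + 𝟙 (adj u x))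
    expand u rewrite 𝟙-insert S s u | deg-insert S s u | ℕ.*-distribʳ-+ (deg S u + 𝟙 (adj u x)) (𝟙 (S u)) (𝟙 (u == x))
      | ℕ.*-distribˡ-+ (𝟙 (S u)) (deg S u) (𝟙 (adj u x)) | 𝟙-∧ (S u) (adj x u) | adj-sym x u = refl

  edges-delete : ∀ (S : V → Bool) {x} → S x ≡ true →
                 edges S ≡ edges (delete S x) + (deg (delete S x) x + deg (delete S x) x)
  edges-delete S {x} s = trans (edges-cong (insert-delete S s)) (edges-insert (delete S x) (delete-self S x))

  -- A crude bound, enough to stop the climb to a densest maximum forest.
  edges≤ : ∀ (S : V → Bool) → edges S ≤ n * n
  edges≤ S = sum≤ _ λ u → ℕ.≤-trans (ℕ.*-monoˡ-≤ (deg S u) (𝟙≤1 (S u))) (ℕ.≤-trans (ℕ.≤-reflexive (ℕ.+-identityʳ _)) (count≤ (nbrs S u)))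
    where
    𝟙≤1 : ∀ b → 𝟙 b ≤ 1
    𝟙≤1 true = ℕ.≤-refl
    𝟙≤1 false = z≤n
    sum≤ : ∀ {m k} (g : Fin m → ℕ) → (∀ i → g i ≤ k) → sum g ≤ m * k
    sum≤ {zero} g _ = z≤n
    sum≤ {suc m} g b = ℕ.+-mono-≤ (b zero) (sum≤ (g ∘ suc) (b ∘ suc))
    count≤ : ∀ {m} (S : Fin m → Bool) → count S ≤ m
    count≤ {m} S = ℕ.≤-trans (sum≤ (𝟙 ∘ S) (𝟙≤1 ∘ S)) (ℕ.≤-reflexive (ℕ.*-identityʳ m))

-- Rainbow walks and recolouring around new vertices

module Rainbow (G : Graph) where
  open Graph G using (n; adj)
  open Walks G

  VSet : Set
  VSet = V → Bool

  infix 4 _∈_ _∉_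
  _∈_ _∉_ : V → VSet → Set
  x ∈ S = S x ≡ true
  x ∉ S = S x ≡ false

  ∈∉⊥ : ∀ {S x} → x ∈ S → x ∉ S → ⊥
  ∈∉⊥ p q with trans (sym p) q
  ... | ()

  _∪_ : VSet → VSet → VSet
  (S ∪ S′) v = S v ∨ S′ v

  ∪ˡ : ∀ {S S′ x} → x ∈ S → x ∈ S ∪ S′
  ∪ˡ p rewrite p = refl

  ∪ʳ : ∀ {S S′ x} → x ∈ S′ → x ∈ S ∪ S′
  ∪ʳ {S} {x = x} p rewrite p = Bool.∨-zeroʳ (S x)

  ∪-split : ∀ {S S′ x} → x ∈ S ∪ S′ → x ∈ S ⊎ x ∈ S′
  ∪-split {S} {x = x} p with S x
  ... | true = inj₁ refl
  ... | false = inj₂ p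

  ∪-∉ : ∀ {S S′ x} → x ∉ S → x ∉ S′ → x ∉ S ∪ S′
  ∪-∉ p q rewrite p = q

  insert-split : ∀ {S y x} → x ∈ insert S y → x ∈ S ⊎ x ≡ y
  insert-split {S} {y} = Sum.map₂ ==-true ∘ ∪-split {S} {_== y}

  insert-∉ : ∀ {S y x} → x ∉ S → x ≢ y → x ∉ insert S y
  insert-∉ {S} {y} p ne = ∪-∉ {S} {_== y} p (==-false ne)

  insert-self : ∀ {S x} → x ∈ insert S x
  insert-self {S} {x} = ∪ʳ {S} {_== x} (==-refl x)

  insert-∉⁻ : ∀ {S y x} → x ∉ insert S y → x ∉ S × x ≢ y
  insert-∉⁻ {S} {y} {x} p with S x in eq | x Fin.≟ y
  insert-∉⁻ () | true | _
  insert-∉⁻ () | false | yes _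
  ... | false | no ne = refl , ne

  Col : Set
  Col = V ⊎ Bool

  Coloring : Set
  Coloring = V → V → Col

  -- Walks in P with distinct colours satisfying Q; distinctness is enforced by shrinking Q along the walk.
  data RW (col : Coloring) (P : VSet) (Q : Col → Set) : V → V → Set where
    nil  : ∀ {u} → u ∈ P → RW col P Q u u
    cons : ∀ {u w v} → u ∈ P → u ~ w → Q (col u w) →
           RW col P (λ c → Q c × c ≢ col u w) w v → RW col P Q u v

  rw-source : ∀ {col P Q u v} → RW col P Q u v → u ∈ P
  rw-source (nil p) = p
  rw-source (cons p _ _ _) = p

  rw-target : ∀ {col P Q u v} → RW col P Q u v → v ∈ P
  rw-target (nil p) = p
  rw-target (cons _ _ _ r) = rw-target r

  transport : ∀ {col col′ P P′ Q Q′} → (∀ {x y} → x ∈ P → y ∈ P → col′ x y ≡ col x y) →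
              (∀ {x} → x ∈ P → x ∈ P′) → (∀ {c} → Q c → Q′ c) →
              ∀ {u v} → RW col P Q u v → RW col′ P′ Q′ u v
  transport agree f g (nil p) = nil (f p)
  transport {Q′ = Q′} agree f g (cons p e q r) =
    cons (f p) e (subst Q′ (sym eq) (g q)) (transport agree f (λ (q , ne) → g q , λ d → ne (trans d eq)) r)
    where eq = agree p (rw-source r)

  weaken : ∀ {col P Q Q′} → (∀ {c} → Q c → Q′ c) → ∀ {u v} → RW col P Q u v → RW col P Q′ u v
  weaken = transport (λ _ _ → refl) id

  -- Disjoint colour budgets replace any comparison of the colours of the two walks; all later
  -- concatenations rest on this.
  join : ∀ {col P Q₁ Q₂ Q} → (∀ {c} → Q₁ c → Q c) → (∀ {c} → Q₂ c → Q c) → (∀ {c} → Q₁ c → Q₂ c → ⊥) →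
         ∀ {u v w} → RW col P Q₁ u v → RW col P Q₂ v w → RW col P Q u w
  join f g dis (nil _) r = weaken g r
  join {Q₂ = Q₂} f g dis (cons p e q r₁) r₂ =
    cons p e (f q) (join (λ (q , ne) → f q , ne) (λ q₂ → g q₂ , λ { refl → dis q q₂ }) (λ (q , _) → dis q) r₁ r₂)

  rw-edge : ∀ {col P} {Q : Col → Set} {u v} → u ∈ P → v ∈ P → u ~ v → Q (col u v) → RW col P Q u v
  rw-edge p q e c = cons p e c (nil q)

  rw-cons : ∀ {col P} {Q Q′ : Col → Set} {u w v c} → u ∈ P → u ~ w → col u w ≡ c → Q′ c → (∀ {d} → Q d → Q′ d) → ¬ Q c →
            RW col P Q w v → RW col P Q′ u v
  rw-cons p e refl c f fresh r = cons p e c (weaken (λ q → f q , λ { refl → fresh q }) r)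

  rw-snoc : ∀ {col P} {Q Q′ : Col → Set} {u w v c} → v ∈ P → w ~ v → col w v ≡ c → Q′ c → (∀ {d} → Q d → Q′ d) → ¬ Q c →
            RW col P Q u w → RW col P Q′ u v
  rw-snoc {c = c} p e eq c′ f fresh r =
    join {Q₂ = _≡ c} f (λ { refl → c′ }) (λ { q refl → fresh q }) r (rw-edge (rw-target r) p e eq)

  reverse : ∀ {col P Q} → (∀ u v → col u v ≡ col v u) → ∀ {u v} → RW col P Q u v → RW col P Q v u
  reverse _ (nil p) = nil p
  reverse s (cons {u} {w} p e q r) =
    rw-snoc p (~-sym e) (s w u) q proj₁ (λ (_ , ne) → ne refl) (reverse s r)

  assemble : ∀ {col P Q} {S : V → Set} {N : VSet} → (∀ u v → col u v ≡ col v u) →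
             (∀ {x y} → S x → S y → RW col P Q x y) → (∀ {x y} → x ∈ N → S y → RW col P Q x y) →
             (∀ {x y} → x ∈ N → y ∈ N → x ≢ y → RW col P Q x y) → (∀ {x} → x ∈ N → x ∈ P) →
             ∀ {x y} → S x ⊎ x ∈ N → S y ⊎ y ∈ N → RW col P Q x y
  assemble s ss ns nn N⊆P (inj₁ x) (inj₁ y) = ss x y
  assemble s ss ns nn N⊆P (inj₁ x) (inj₂ y) = reverse s (ns y x)
  assemble s ss ns nn N⊆P (inj₂ x) (inj₁ y) = ns x y
  assemble s ss ns nn N⊆P {x′} {y′} (inj₂ x) (inj₂ y) with x′ Fin.≟ y′
  ... | yes refl = nil (N⊆P x)
  ... | no ne = nn x y ne

  -- `att` marks the edges by which the new vertices `N` are hung. Edges from `N` to vertices not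
  -- yet placed are painted too; they are painted over when their other end is placed.
  module Paint (col : Coloring) (col-sym : ∀ u v → col u v ≡ col v u) (N : VSet) (att : V → V → Bool) (σ ω : Col) where

    private
      pick : Bool → Col
      pick b = if b then σ else ω

    paint : Coloring
    paint u v = if N u then (if N v then ω else pick (att u v)) else (if N v then pick (att v u) else col u v)

    paint-sym : ∀ u v → paint u v ≡ paint v u
    paint-sym u v with N u | N v
    ... | true | true = refl
    ... | true | false = refl
    ... | false | true = refl
    ... | false | false = col-sym u v

    paint-old : ∀ {u v} → u ∉ N → v ∉ N → paint u v ≡ col u v
    paint-old p q rewrite p | q = refl

    paint-hit : ∀ {u v} → u ∈ N → v ∉ N → att u v ≡ true → paint u v ≡ σ
    paint-hit p q r rewrite p | q | r = refl

    paint-miss : ∀ {u v} → u ∈ N → v ∉ N → att u v ≡ false → paint u v ≡ ω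
    paint-miss p q r rewrite p | q | r = refl

    paint-inner : ∀ {u v} → u ∈ N → v ∈ N → paint u v ≡ ω
    paint-inner p q rewrite p | q = refl

  -- Colour budgets, and hanging vertices on the placed set

  Good : (V → Set) → (Bool → Set) → Col → Set
  Good U L (inj₁ x) = U x
  Good U L (inj₂ b) = L b

  Any : Bool → Set
  Any _ = ⊤

  _⊕_ : (V → Set) → V → V → Set
  (U ⊕ s) x = U x ⊎ x ≡ s

  good-mono : ∀ {U U′ L L′} → (∀ {x} → U x → U′ x) → (∀ {b} → L b → L′ b) → ∀ {c} → Good U L c → Good U′ L′ c
  good-mono f g {inj₁ x} = f
  good-mono f g {inj₂ b} = g

  good-disjoint : ∀ {U U′ L L′} → (∀ {x} → U x → U′ x → ⊥) → (∀ {b} → L b → L′ b → ⊥) →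
                  ∀ {c} → Good U L c → Good U′ L′ c → ⊥
  good-disjoint f g {inj₁ x} = f
  good-disjoint f g {inj₂ b} = g

  -- inj₁ x is the colour named after the vertex x of the forest, inj₂ b is one of the two extra colours.
  -- U is the set of names in use, and C is a part of P that is connected with extra colours in L only.
  record State (P : VSet) (C U : V → Set) (L : Bool → Set) : Set where
    field
      col     : Coloring
      col-sym : ∀ u v → col u v ≡ col v u
      C⊆P     : ∀ {x} → C x → x ∈ P
      connP   : ∀ {x y} → x ∈ P → y ∈ P → RW col P (Good U Any) x y
      connC   : ∀ {x y} → C x → C y → RW col P (Good U L) x y

  open State

  relax : ∀ {P C U L C′ U′ L′} → (∀ {x} → C′ x → C x) → (∀ {x} → U x → U′ x) → (∀ {b} → L b → L′ b) →
          State P C U L → State P C′ U′ L′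
  relax f g h st = record
    { col = col st ; col-sym = col-sym st ; C⊆P = C⊆P st ∘ f
    ; connP = λ x y → weaken (λ {c} → good-mono g id {c}) (connP st x y)
    ; connC = λ x y → weaken (λ {c} → good-mono g h {c}) (connC st (f x) (f y)) }

  module Step {P : VSet} (col : Coloring) (col-sym : ∀ u v → col u v ≡ col v u)
              (N : VSet) (N∩P : ∀ x → x ∈ N → x ∉ P) (att : V → V → Bool) (s : V) (b : Bool) where

    open Paint col col-sym N att (inj₁ s) (inj₂ b) public

    P′ : VSet
    P′ = P ∪ N

    N⊆P′ : ∀ {x} → x ∈ N → x ∈ P′
    N⊆P′ = ∪ʳ {P} {N}

    P⊆P′ : ∀ {x} → x ∈ P → x ∈ P′
    P⊆P′ = ∪ˡ {P} {N}

    ∉N : ∀ {x} → x ∈ P → x ∉ N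
    ∉N {x} p with N x in eq
    ... | false = refl
    ... | true = ⊥-elim (∈∉⊥ {P} p (N∩P x eq))

    old : ∀ {Q Q′ : Col → Set} → (∀ {c} → Q c → Q′ c) → ∀ {u v} → RW col P Q u v → RW paint P′ Q′ u v
    old = transport (λ p q → paint-old (∉N p) (∉N q)) P⊆P′

    up : ∀ {U U′ L L′} → ¬ U s → U′ s → (∀ {x} → U x → U′ x) → (∀ {b} → L b → L′ b) →
         ∀ {x z y} → x ∈ N → x ~ z → att x z ≡ true → RW col P (Good U L) z y → RW paint P′ (Good U′ L′) x y
    up fresh s′ g f m e eq r =
      rw-cons (N⊆P′ m) e (paint-hit m (∉N (rw-source r)) eq) s′ (λ {c} → good-mono g f {c}) fresh (old id r)

  singleton-∈ : ∀ {x y : V} → y ≡ x → y ∈ (_== x)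
  singleton-∈ {x} refl = ==-refl x

  singleton-only : ∀ {x y z} {A : Set} → y ∈ (_== x) → z ∈ (_== x) → y ≢ z → A
  singleton-only {x} {y} {z} p q ne = ⊥-elim (ne (trans (==-true {i = y} {x} p) (sym (==-true {i = z} {x} q))))

  singleton-∉ : ∀ {P : VSet} {x} → x ∉ P → ∀ y → y ∈ (_== x) → y ∉ P
  singleton-∉ {P} x∉ y m = subst (_∉ P) (sym (==-true {i = y} m)) x∉

  -- A single vertex is connected by the empty walk, so no extra colour is spent in it. This frees
  -- both extra colours for the next component.
  refocus : ∀ {P C U L L′ v} → State P C U L → v ∈ P → State P (_≡ v) U L′
  refocus st v∈ = record
    { col = col st ; col-sym = col-sym st ; C⊆P = λ { refl → v∈ } ; connP = connP st ; connC = λ { refl refl → nil v∈ } }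

  forget : ∀ {P C U L} → State P C U L → State P (λ _ → ⊥) U (λ _ → ⊥)
  forget st = record { col = col st ; col-sym = col-sym st ; C⊆P = λ () ; connP = connP st ; connC = λ () }

  -- The colour `s` is independent of x: a forest vertex gets its own name, but an outside vertex
  -- has none and gets a name that an ear saves.
  leafStep : ∀ {P C U L x v s} → State P C U L → x ∉ P → C v → x ~ v → ¬ U s →
             State (insert P x) (C ⊕ x) (U ⊕ s) L
  leafStep {P} {C} {U} {L} {x} {v} {s} st x∉ Cv xv fresh = record
    { col = paint ; col-sym = paint-sym
    ; C⊆P = λ { (inj₁ c) → P⊆P′ (C⊆P st c) ; (inj₂ refl) → insert-self {P} }
    ; connP = λ p q → assemble paint-sym (λ p q → old (λ {c} → good-mono inj₁ id {c}) (connP st p q))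
                        (λ {y} m q → up′ {y = y} m (connP st (C⊆P st Cv) q)) (λ {y} {z} → singleton-only {y = y} {z}) N⊆P′ (∪-split {P} {_== x} p) (∪-split {P} {_== x} q)
    ; connC = λ p q → assemble paint-sym (λ p q → old (λ {c} → good-mono inj₁ id {c}) (connC st p q))
                        (λ {y} m q → up′ {y = y} m (connC st Cv q)) (λ {y} {z} → singleton-only {y = y} {z}) N⊆P′ (Sum.map₂ singleton-∈ p) (Sum.map₂ singleton-∈ q) }
    where
    open Step (col st) (col-sym st) (_== x) (singleton-∉ {P} x∉) (λ _ → _== v) s true
    up′ : ∀ {L y z} → y ∈ (_== x) → RW (col st) P (Good U L) v z → RW paint P′ (Good (U ⊕ s) L) y z
    up′ {y = y} m = up fresh (inj₂ refl) inj₁ id {y} m (subst (_~ v) (sym (==-true {i = y} m)) xv) (==-refl v)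

  -- All anchor edges share the colour `s`, so a walk between two vertices of `N` may use only one
  -- of them. It leaves by an anchor edge, crosses `C`, and arrives by an edge to a second
  -- neighbour; that edge has colour `b`, which walks within `C` avoid. From `N` to the placed
  -- vertices one anchor edge suffices.
  outerStep : ∀ {P C U L} (st : State P C U L) (N : VSet) → (∀ {x} → x ∈ N → x ∉ P) →
              (a : V → V) → (∀ {x} → x ∈ N → C (a x) × x ~ a x) →
              ∀ {s} → ¬ U s → ∀ {b} → ¬ L b →
              (∀ {x y} → x ∈ N → y ∈ N → x ≢ y →
                 x ~ y ⊎ (∃[ z ] (C z × z ≢ a x × x ~ z)) ⊎ (∃[ z ] (C z × z ≢ a y × y ~ z))) →
              State (P ∪ N) (λ x → C x ⊎ x ∈ N) (U ⊕ s) (λ b′ → L b′ ⊎ b′ ≡ b)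
  outerStep {P} {C} {U} {L} st N N∩P a att {s} fresh {b} b∉L pairs = record
    { col = paint ; col-sym = paint-sym
    ; C⊆P = λ { (inj₁ c) → P⊆P′ (C⊆P st c) ; (inj₂ m) → N⊆P′ m }
    ; connP = λ p q → assemble paint-sym (λ p q → old (λ {c} → good-mono inj₁ id {c}) (connP st p q))
                        (λ m q → up′ id m (connP st (C⊆P st (proj₁ (att m))) q)) (nn (λ _ → tt) tt) N⊆P′ (∪-split {P} {N} p) (∪-split {P} {N} q)
    ; connC = λ p q → assemble paint-sym (λ p q → old (λ {c} → good-mono inj₁ inj₁ {c}) (connC st p q))
                        (λ m q → up′ inj₁ m (connC st (proj₁ (att m)) q)) (nn inj₁ (inj₂ refl)) N⊆P′ p q }
    where
    open Step (col st) (col-sym st) N (λ x → N∩P {x}) (λ x → _== a x) s b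
    up′ : ∀ {L L′} → (∀ {b} → L b → L′ b) → ∀ {x y} → x ∈ N → RW (col st) P (Good U L) (a x) y → RW paint P′ (Good (U ⊕ s) L′) x y
    up′ f {x} m = up fresh (inj₂ refl) inj₁ f m (proj₂ (att m)) (==-refl (a x))
    via : ∀ {L′} → (∀ {b} → L b → L′ b) → L′ b → ∀ {x y z} → x ∈ N → y ∈ N → C z → z ≢ a y → y ~ z →
          RW paint P′ (Good (U ⊕ s) L′) x y
    via f l {x} {y} {z} x∈ y∈ Cz ne yz =
      rw-snoc {Q = Good (U ⊕ s) L} (N⊆P′ y∈) (~-sym yz)
        (trans (paint-sym z y) (paint-miss y∈ (∉N (C⊆P st Cz)) (==-false ne))) l (λ {c} → good-mono id f {c}) b∉L
        (up′ id x∈ (connC st (proj₁ (att x∈)) Cz))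
    nn : ∀ {L′} → (∀ {b} → L b → L′ b) → L′ b → ∀ {x y} → x ∈ N → y ∈ N → x ≢ y → RW paint P′ (Good (U ⊕ s) L′) x y
    nn {L′} f l x∈ y∈ x≢y with pairs x∈ y∈ x≢y
    ... | inj₁ xy = rw-edge (N⊆P′ x∈) (N⊆P′ y∈) xy (subst (Good (U ⊕ s) L′) (sym (paint-inner x∈ y∈)) l)
    ... | inj₂ (inj₁ (z , Cz , ne , xz)) = reverse paint-sym (via f l y∈ x∈ Cz ne xz)
    ... | inj₂ (inj₂ (z , Cz , ne , yz)) = via f l x∈ y∈ Cz ne yz

  -- Ears that save a colour

  -- The part p₀ … q of an ear at w that has been placed so far; c is its last vertex, still to be placed.
  record Arm (P : VSet) (C U : V → Set) (L : Bool → Set) (w p₀ q c : V) (P′ : VSet) (R W : V → Set) : Set where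
    field
      acol  : Coloring
      asym  : ∀ u v → acol u v ≡ acol v u
      P⊆    : ∀ {x} → x ∈ P → x ∈ P′
      R⊆    : ∀ {x} → R x → x ∈ P′
      split : ∀ {x} → x ∈ P′ → x ∈ P ⊎ R x
      W⊆R   : ∀ {x} → W x → R x × x ≢ p₀
      oldP  : ∀ {x y} → x ∈ P → y ∈ P → RW acol P′ (Good U Any) x y
      oldC  : ∀ {x y} → C x → C y → RW acol P′ (Good U L) x y
      connR : ∀ {x y} → R x → R y → RW acol P′ (Good W (λ _ → ⊥)) x y
      Rp₀   : R p₀
      Rq    : R q
      p₀~w  : p₀ ~ w
      p₀w   : acol p₀ w ≡ inj₁ c

  -- The edge `p₀w` already bears the name of `c`, the vertex placed last, so that the name of `p₀`
  -- is never spent on the ear.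
  armStart : ∀ {P C U L w p₀ c} → State P C U L → w ∈ P → p₀ ∉ P → p₀ ~ w →
             Arm P C U L w p₀ p₀ c (insert P p₀) (_≡ p₀) (λ _ → ⊥)
  armStart {P} {w = w} {p₀} {c} st w∈ p₀∉ p₀w = record
    { acol = paint ; asym = paint-sym ; P⊆ = P⊆P′ ; R⊆ = λ { refl → insert-self {P} } ; split = insert-split {P} ; W⊆R = λ ()
    ; oldP = λ p q → old id (connP st p q) ; oldC = λ p q → old id (connC st p q)
    ; connR = λ { refl refl → nil (insert-self {P}) } ; Rp₀ = refl ; Rq = refl ; p₀~w = p₀w
    ; p₀w = paint-hit {p₀} {w} (==-refl p₀) (∉N w∈) (==-refl w) }
    where
    open Step (col st) (col-sym st) (_== p₀) (singleton-∉ {P} p₀∉) (λ _ → _== w) c true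

  armStep : ∀ {P C U L w p₀ q c P′ R W x} → Arm P C U L w p₀ q c P′ R W → w ∈ P → x ∉ P′ → x ~ q →
            Arm P C U L w p₀ x c (insert P′ x) (R ⊕ x) (W ⊕ x)
  armStep {q = q} {P′ = Pₐ} {R} {W} {x} arm w∈ x∉ xq = record
    { acol = paint ; asym = paint-sym ; P⊆ = P⊆P′ ∘ P⊆
    ; R⊆ = λ { (inj₁ r) → P⊆P′ (R⊆ r) ; (inj₂ refl) → insert-self {Pₐ} }
    ; split = λ p → Sum.assocʳ (Sum.map₁ split (insert-split {Pₐ} p))
    ; W⊆R = λ { (inj₁ m) → inj₁ (proj₁ (W⊆R m)) , proj₂ (W⊆R m) ; (inj₂ refl) → inj₂ refl , λ { refl → ∈∉⊥ {Pₐ} (R⊆ Rp₀) x∉ } }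
    ; oldP = λ p q → old id (oldP p q) ; oldC = λ p q → old id (oldC p q)
    ; connR = λ p r → assemble paint-sym (λ p r → old (λ {c} → good-mono inj₁ id {c}) (connR p r))
                (λ {y} m r → up (λ m → ∈∉⊥ {Pₐ} (R⊆ (proj₁ (W⊆R m))) x∉) (inj₂ refl) inj₁ id {y} m (subst (_~ q) (sym (==-true {i = y} m)) xq) (==-refl q) (connR Rq r))
                (λ {y} {z} → singleton-only {y = y} {z}) N⊆P′ (Sum.map₂ singleton-∈ p) (Sum.map₂ singleton-∈ r)
    ; Rp₀ = inj₁ Rp₀ ; Rq = inj₂ refl ; p₀~w = p₀~w
    ; p₀w = trans (paint-old (∉N (R⊆ Rp₀)) (∉N (P⊆ w∈))) p₀w }
    where
    open Arm arm
    open Step acol asym (_== x) (singleton-∉ {Pₐ} x∉) (λ _ → _== q) x true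

  -- The three edges p₀w, cw and cq share the colour c, yet the walks built here use c at most once:
  -- c reaches the old part through w and the arm through q.
  armClose : ∀ {P C U L w p₀ q c P′ R W} → Arm P C U L w p₀ q c P′ R W → (∀ {x} → C x → x ∈ P) → C w →
             c ∉ P′ → c ~ q → c ~ w → ¬ U c → (∀ {x} → U x → W x → ⊥) →
             State (insert P′ c) (λ x → (C x ⊎ R x) ⊎ x ≡ c) (λ x → (U x ⊎ W x) ⊎ x ≡ c) L
  armClose {P} {C} {U} {L} {w} {p₀} {q} {c} {Pₐ} {R} {W} arm C⊆ Cw c∉ cq cw c∉U dis = record
    { col = paint ; col-sym = paint-sym
    ; C⊆P = λ { (inj₁ (inj₁ m)) → P⊆P′ (P⊆ (C⊆ m)) ; (inj₁ (inj₂ m)) → P⊆P′ (R⊆ m) ; (inj₂ refl) → insert-self {Pₐ} }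
    ; connP = λ p r → family {_∈ P} oldP (C⊆ Cw) (Sum.map₁ split (insert-split {Pₐ} p)) (Sum.map₁ split (insert-split {Pₐ} r))
    ; connC = family {C} oldC Cw }
    where
    open Arm arm
    open Step acol asym (_== c) (singleton-∉ {Pₐ} c∉) (λ _ v → (v == w) ∨ (v == q)) c true
    c∉W : ¬ W c
    c∉W m = ∈∉⊥ {Pₐ} (R⊆ (proj₁ (W⊆R m))) c∉
    U′ : V → Set
    U′ x = (U x ⊎ W x) ⊎ x ≡ c
    hitw : (w == w) ∨ (w == q) ≡ true
    hitw rewrite ==-refl w = refl
    hitq : (q == w) ∨ (q == q) ≡ true
    hitq rewrite ==-refl q = Bool.∨-zeroʳ (q == w)
    family : ∀ {S : V → Set} {L} → (∀ {x y} → S x → S y → RW acol Pₐ (Good U L) x y) → S w →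
             ∀ {x y} → (S x ⊎ R x) ⊎ x ≡ c → (S y ⊎ R y) ⊎ y ≡ c → RW paint P′ (Good U′ L) x y
    family {S} {L} conn Sw p r =
      assemble paint-sym (λ p r → old id (pair p r)) (λ {y} m r → close {y} m r) (λ {y} {z} → singleton-only {y = y} {z}) N⊆P′
        (Sum.map₂ singleton-∈ p) (Sum.map₂ singleton-∈ r)
      where
      cross : ∀ {x y} → R x → S y → RW acol Pₐ (Good U′ L) x y
      cross Rx Sy = join (λ {c} → good-mono (inj₁ ∘ inj₂) (λ ()) {c}) (λ {c} → good-mono {U ⊕ c′} (Sum.map₁ inj₁) id {c})
                      (λ {c} → good-disjoint {W} {U ⊕ c′} (λ { m (inj₁ u) → dis u m ; m (inj₂ refl) → c∉W m }) (λ ()) {c})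
                      (connR Rx Rp₀)
                      (rw-cons (R⊆ Rp₀) p₀~w p₀w (inj₂ refl) (λ {c} → good-mono inj₁ id {c}) c∉U (conn Sw Sy))
        where c′ = c
      pair : ∀ {x y} → S x ⊎ R x → S y ⊎ R y → RW acol Pₐ (Good U′ L) x y
      pair (inj₁ p) (inj₁ r) = weaken (λ {c} → good-mono (inj₁ ∘ inj₁) id {c}) (conn p r)
      pair (inj₁ p) (inj₂ r) = reverse asym (cross r p)
      pair (inj₂ p) (inj₁ r) = cross p r
      pair (inj₂ p) (inj₂ r) = weaken (λ {c} → good-mono (inj₁ ∘ inj₂) (λ ()) {c}) (connR p r)
      close : ∀ {x y} → x ∈ (_== c) → S y ⊎ R y → RW paint P′ (Good U′ L) x y
      close {x} m (inj₁ r) = up c∉U (inj₂ refl) (inj₁ ∘ inj₁) id {x} m (subst (_~ w) (sym (==-true {i = x} m)) cw) hitw (conn Sw r)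
      close {x} m (inj₂ r) = up c∉W (inj₂ refl) (inj₁ ∘ inj₂) (λ ()) {x} m (subst (_~ q) (sym (==-true {i = x} m)) cq) hitq (connR Rq r)

  -- The gain is in `U″⊆`: the ear adds no use of the name `p₀`, and `L` is unchanged, so no extra
  -- colour is spent either.
  record Ear (P : VSet) (C U : V → Set) (L : Bool → Set) (New : V → Set) (p₀ : V) : Set₁ where
    field
      {P″}  : VSet
      {C″ U″} : V → Set
      state : State P″ C″ U″ L
      P⊆P″  : ∀ {x} → x ∈ P → x ∈ P″
      P″⊆   : ∀ {x} → x ∈ P″ → x ∈ P ⊎ New x
      C⊆C″  : ∀ {x} → C x → C″ x
      New⊆C″ : ∀ {x} → New x → C″ x
      U″⊆   : ∀ {x} → U″ x → U x ⊎ (New x × x ≢ p₀)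

  private
    earGo : ∀ {P C U L w p₀ q c P′ R W x} → Arm P C U L w p₀ q c P′ R W → (∀ {x} → C x → x ∈ P) → C w →
            (∀ {x} → U x → W x → ⊥) → x ~ q → c ~ w →
            (p : Walk G x c) → IsPath G p → (∀ {y} → y ∈ᴸ vertices G p → y ∉ P′ × ¬ U y) →
            Ear P C U L (λ y → R y ⊎ y ∈ᴸ vertices G p) p₀
    earGo {c = c} {P′} arm C⊆ Cw dis xq cw stop _ unplaced = record
      { state = armClose arm C⊆ Cw (proj₁ (unplaced (here refl))) xq cw (proj₂ (unplaced (here refl))) dis
      ; P⊆P″ = λ m → ∪ˡ {P′} {_== c} (P⊆ m)
      ; P″⊆ = λ m → Sum.assocʳ (Sum.map split here (insert-split {P′} m))
      ; C⊆C″ = inj₁ ∘ inj₁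
      ; New⊆C″ = λ { (inj₁ r) → inj₁ (inj₂ r) ; (inj₂ (here eq)) → inj₂ eq }
      ; U″⊆ = λ { (inj₁ (inj₁ u)) → inj₁ u ; (inj₁ (inj₂ m)) → inj₂ (inj₁ (proj₁ (W⊆R m)) , proj₂ (W⊆R m))
                ; (inj₂ refl) → inj₂ (inj₂ (here refl) , λ { refl → ∈∉⊥ {P′} (R⊆ Rp₀) (proj₁ (unplaced (here refl))) }) } }
      where open Arm arm
    earGo {P′ = P′} {x = x} arm C⊆ Cw dis xq cw (step e p) (a ∷ pp) unplaced = record
      { state = state ; P⊆P″ = P⊆P″ ; C⊆C″ = C⊆C″ ; P″⊆ = Sum.map₂ from ∘ P″⊆ ; New⊆C″ = New⊆C″ ∘ to
      ; U″⊆ = λ u → Sum.map₂ (λ (m , ne) → from m , ne) (U″⊆ u) }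
      where
      arm′ = armStep arm (C⊆ Cw) (proj₁ (unplaced (here refl))) xq
      from : ∀ {A : Set} {y xs} → (A ⊎ y ≡ x) ⊎ y ∈ᴸ xs → A ⊎ y ∈ᴸ (x ∷ xs)
      from (inj₁ (inj₁ r)) = inj₁ r
      from (inj₁ (inj₂ eq)) = inj₂ (here eq)
      from (inj₂ m) = inj₂ (there m)
      to : ∀ {A : Set} {y xs} → A ⊎ y ∈ᴸ (x ∷ xs) → (A ⊎ y ≡ x) ⊎ y ∈ᴸ xs
      to (inj₁ r) = inj₁ (inj₁ r)
      to (inj₂ (here eq)) = inj₁ (inj₂ eq)
      to (inj₂ (there m)) = inj₂ m
      rest = earGo arm′ C⊆ Cw (λ { u (inj₁ m) → dis u m ; u (inj₂ refl) → proj₂ (unplaced (here refl)) u }) (~-sym e) cw p pp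
                  (λ m → insert-∉ {P′} (proj₁ (unplaced (there m))) (λ { refl → All.lookup a m refl }) , proj₂ (unplaced (there m)))
      open Ear rest

  -- Freshness is not asked of the name `a`: it may already colour the edge that joins `w` to the
  -- older part.
  ear : ∀ {P C U L w a b} → State P C U L → C w → a ~ w → b ~ w → a ≢ b → (p : Walk G a b) → IsPath G p →
        (∀ {y} → y ∈ᴸ vertices G p → y ∉ P) → (∀ {y} → y ∈ᴸ vertices G p → y ≢ a → ¬ U y) →
        Ear P C U L (_∈ᴸ vertices G p) a
  ear st Cw aw bw a≢b stop _ _ _ = ⊥-elim (a≢b refl)
  ear {P} {a = a} st Cw aw bw a≢b (step e p) (d ∷ pp) unplaced fresh = record
    { state = state ; P⊆P″ = P⊆P″ ; C⊆C″ = C⊆C″ ; P″⊆ = Sum.map₂ from ∘ P″⊆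
    ; New⊆C″ = λ { (here eq) → New⊆C″ (inj₁ eq) ; (there m) → New⊆C″ (inj₂ m) }
    ; U″⊆ = λ u → Sum.map₂ (λ (m , ne) → from m , ne) (U″⊆ u) }
    where
    from : ∀ {y xs} → y ≡ a ⊎ y ∈ᴸ xs → y ∈ᴸ (a ∷ xs)
    from (inj₁ eq) = here eq
    from (inj₂ m) = there m
    rest = earGo (armStart st (C⊆P st Cw) (unplaced (here refl)) aw) (C⊆P st) Cw (λ _ ()) (~-sym e) bw p pp
                (λ m → insert-∉ {P} (unplaced (there m)) (λ { refl → All.lookup d m refl })
                     , fresh (there m) (λ { refl → All.lookup d m refl }))
    open Ear rest

-- From colour names to numbered colours

index : ∀ {n} (S : Fin n → Bool) (x : Fin n) → S x ≡ true → Fin (count S)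
index S zero m = subst (λ b → Fin (𝟙 b + count (S ∘ suc))) (sym m) zero
index S (suc x) m = 𝟙 (S zero) Fin⁺.↑ʳ index (S ∘ suc) x m

index-injective : ∀ {n} (S : Fin n → Bool) {x y} (p : S x ≡ true) (q : S y ≡ true) → index S x p ≡ index S y q → x ≡ y
index-injective S {zero} {zero} p q eq = refl
index-injective S {zero} {suc y} p q eq = ⊥-elim (first≢ p eq)
  where
  first≢ : ∀ {k b} {i : Fin k} (m : b ≡ true) → subst (λ b → Fin (𝟙 b + k)) (sym m) zero ≢ 𝟙 b Fin⁺.↑ʳ i
  first≢ refl ()
index-injective S {suc x} {zero} p q eq = sym (index-injective S q p (sym eq))
index-injective S {suc x} {suc y} p q eq = cong suc (index-injective (S ∘ suc) p q (Fin.↑ʳ-injective (𝟙 (S zero)) _ _ eq))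

module Finish (G : Graph) where
  open Graph G using (n; adj)
  open Walks G
  open Rainbow G

  module Encode (F : VSet) where
    enc⊎ : Col → Fin (count F) ⊎ Fin 2
    enc⊎ (inj₁ x) with F x Bool.≟ true
    ... | yes m = inj₁ (index F x m)
    -- An arbitrary value: names outside `F` lie outside the budget on which injectivity is claimed.
    ... | no _ = inj₂ zero
    enc⊎ (inj₂ false) = inj₂ zero
    enc⊎ (inj₂ true) = inj₂ (suc zero)

    enc : Col → Fin (count F + 2)
    enc = Fin⁺.join (count F) 2 ∘ enc⊎

    enc⊎-injective : ∀ {c d} → Good (_∈ F) Any c → Good (_∈ F) Any d → enc⊎ c ≡ enc⊎ d → c ≡ d
    enc⊎-injective {inj₁ x} {inj₁ y} p q eq with F x Bool.≟ true | F y Bool.≟ true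
    ... | yes p′ | yes q′ = cong inj₁ (index-injective F p′ q′ (inj₁-injective eq))
    ... | no ¬p | _ = ⊥-elim (¬p p)
    ... | _ | no ¬q = ⊥-elim (¬q q)
    enc⊎-injective {inj₁ x} {inj₂ b} p q eq with F x Bool.≟ true
    ... | no ¬p = ⊥-elim (¬p p)
    enc⊎-injective {inj₁ x} {inj₂ false} p q () | yes _
    enc⊎-injective {inj₁ x} {inj₂ true} p q () | yes _
    enc⊎-injective {inj₂ b} {inj₁ y} p q eq with F y Bool.≟ true
    ... | no ¬q = ⊥-elim (¬q q)
    enc⊎-injective {inj₂ false} {inj₁ y} p q () | yes _
    enc⊎-injective {inj₂ true} {inj₁ y} p q () | yes _
    enc⊎-injective {inj₂ false} {inj₂ false} p q eq = refl
    enc⊎-injective {inj₂ true} {inj₂ true} p q eq = refl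

    enc-injective : ∀ {c d} → Good (_∈ F) Any c → Good (_∈ F) Any d → enc c ≡ enc d → c ≡ d
    enc-injective {c} {d} p q eq = enc⊎-injective p q
      (trans (sym (Fin.splitAt-join (count F) 2 (enc⊎ c)))
        (trans (cong (Fin⁺.splitAt (count F)) eq) (Fin.splitAt-join (count F) 2 (enc⊎ d))))

  -- `enc` is injective on the budget only, so every numbered colour is kept together with a
  -- preimage satisfying `Q`.
  rw⇒walk : ∀ {k col P Q u v} (enc : Col → Fin k) (c : EdgeColoring G k) →
            (∀ u v → EdgeColoring.col c u v ≡ enc (col u v)) →
            (∀ {c d} → Q c → Q d → enc c ≡ enc d → c ≡ d) → RW col P Q u v →
            Σ[ p ∈ Walk G u v ] (All (λ i → ∃[ d ] (Q d × enc d ≡ i)) (edgeColors G c p) × Unique (edgeColors G c p))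
  rw⇒walk enc c eq inj (nil _) = stop , [] , []
  rw⇒walk enc c eq inj (cons {u} {w} _ e q r) =
    let p , all , uniq = rw⇒walk enc c eq (λ (q , _) (q′ , _) → inj q q′) r in
    step e p , (_ , q , sym (eq u w)) ∷ All.map (λ (d , (q , _) , i) → d , q , i) all ,
    All.map (λ (d , (q′ , ne) , i) same → ne (inj q′ q (trans i (trans (sym same) (eq u w))))) all ∷ uniq

  rainbow : ∀ {P C U L} (F : VSet) → State P C U L → (∀ x → x ∈ P) → (∀ {x} → U x → x ∈ F) →
            RainbowConnectable G (count F + 2)
  rainbow F st all U⊆F = coloring , λ u v →
    let p , _ , uniq = rw⇒walk enc coloring (λ _ _ → refl) enc-injective
                         (weaken (λ {c} → good-mono U⊆F id {c}) (connP (all u) (all v)))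
    in erase p , erase-path p , erase-rainbow coloring p uniq
    where
    open State st
    open Encode F
    coloring : EdgeColoring G (count F + 2)
    coloring = record { col = λ u v → enc (col u v) ; col-sym = λ u v → cong enc (col-sym u v) }

-- The theorem is a stable inequality, so the construction aims at ⊥, where excluded middle is available.
em : ∀ {A : Set} → (A → ⊥) → (¬ A → ⊥) → ⊥
em y n = n y

-- Excluded middle for finitely many statements at once; it turns a property of vertices into a
-- characteristic function.
decAll : ∀ {n} (A : Fin n → Set) → ((∀ v → Dec (A v)) → ⊥) → ⊥
decAll {zero} A k = k (λ ())
decAll {suc n} A k = decAll (A ∘ suc) λ d →
  em (λ a → k λ { zero → yes a ; (suc i) → d i }) (λ a → k λ { zero → no a ; (suc i) → d i })

-- Extremal forests and exchanges

module Main (G : Graph) (f : ℕ) (maxf : ∀ S → ¬ Walks.Cyclic G (λ v → S v ≡ true) → count S ≤ f) where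
  open Graph G using (n; adj)
  open Walks G
  open Degrees G
  open Rainbow G
  open State

  dec∈ : ∀ (S : VSet) x → x ∈ S ⊎ x ∉ S
  dec∈ S x with S x
  ... | true = inj₁ refl
  ... | false = inj₂ refl

  ~⇒≡true : ∀ {u v} → u ~ v → adj u v ≡ true
  ~⇒≡true {u} {v} e with adj u v
  ... | true = refl

  ≡true⇒~ : ∀ {u v} → adj u v ≡ true → u ~ v
  ≡true⇒~ e = subst T (sym e) tt

  delete-∈ : ∀ {S x y} → y ∈ S → y ≢ x → y ∈ delete S x
  delete-∈ {S} = delete-other S

  delete-∈⁻ : ∀ {S x y} → y ∈ delete S x → y ∈ S × y ≢ x
  delete-∈⁻ {S} {x} {y} m with S y | y Fin.≟ x
  ... | true | no ne = refl , ne

  insert-old : ∀ {S x y} → y ∈ S → y ∈ insert S x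
  insert-old {S} {x} = ∪ˡ {S} {_== x}

  cyclic-mono : ∀ {S S′ : V → Set} → (∀ {x} → S x → S′ x) → Cyclic S → Cyclic S′
  cyclic-mono g (u , w , e , p , pp , l , all) = u , w , e , p , pp , l , All.map g all

  insert-acyclic : ∀ {S y} → ¬ Cyclic (_∈ S) → ¬ Double (_∈ S) y → ¬ Cyclic (_∈ insert S y)
  insert-acyclic {S} ac nd = acyclic-insert ac nd ∘ cyclic-mono (insert-split {S})

  delete-acyclic : ∀ {S x} → ¬ Cyclic (_∈ S) → ¬ Cyclic (_∈ delete S x)
  delete-acyclic {S} ac = ac ∘ cyclic-mono (proj₁ ∘ delete-∈⁻ {S})

  record Extremal (F : VSet) : Set where
    field
      acyclic : ¬ Cyclic (_∈ F)
      size    : count F ≡ f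
      densest : ∀ S → ¬ Cyclic (_∈ S) → count S ≡ f → edges S ≤ edges F

  open Extremal

  module _ {F : VSet} (ext : Extremal F) where

    outside-double : ∀ {y} → y ∉ F → ¬ ¬ Double (_∈ F) y
    outside-double y∉ nd =
      ℕ.<-irrefl (size ext) (subst (_≤ f) (count-insert F y∉) (maxf _ (insert-acyclic {F} (acyclic ext) nd)))

    swap-size : ∀ {x y} → x ∈ F → y ∉ F → count (insert (delete F x) y) ≡ f
    swap-size {x} {y} x∈ y∉ = trans (count-insert (delete F x) (cong (_∧ not (y == x)) y∉)) (trans (sym (count-delete F x∈)) (size ext))

    -- F - x + y is again a forest with `f` vertices, hence has no more edges than F; both edge
    -- numbers exceed that of F - x by the degree of the added vertex.
    swap-deg : ∀ {x y} → x ∈ F → y ∉ F → ¬ Double (_∈ delete F x) y → deg (delete F x) y ≤ deg (delete F x) x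
    swap-deg {x} {y} x∈ y∉ nd = halve (ℕ.+-cancelˡ-≤ (edges (delete F x)) _ _
      (subst₂ _≤_ (edges-insert (delete F x) (cong (_∧ not (y == x)) y∉)) (edges-delete F x∈)
        (densest ext _ (insert-acyclic {delete F x} (delete-acyclic {F} (acyclic ext)) nd) (swap-size x∈ y∉))))
      where
      halve : ∀ {a b} → a + a ≤ b + b → a ≤ b
      halve {a} {b} le with a ℕ.≤? b
      ... | yes p = p
      ... | no ¬p = ⊥-elim (ℕ.<⇒≱ (ℕ.+-mono-< (ℕ.≰⇒> ¬p) (ℕ.≰⇒> ¬p)) le)

    -- A second neighbour of y would make F − x + y denser than F.
    swap-single : ∀ {x y a b} → x ∈ F → y ∉ F → ¬ Double (_∈ delete F x) y → deg (delete F x) x ≤ 1 →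
                  a ∈ F → a ≢ x → y ~ a → b ∈ F → b ≢ x → y ~ b → a ≡ b
    swap-single {x} {y} {a} {b} x∈ y∉ nd leaf a∈ a≢x ya b∈ b≢x yb with a Fin.≟ b
    ... | yes eq = eq
    ... | no a≢b = ⊥-elim (ℕ.<⇒≱ (s≤s (s≤s z≤n)) (ℕ.≤-trans (count≥2 (nbrs (delete F x) y) (at a∈ a≢x ya) (at b∈ b≢x yb) a≢b)
                                                 (ℕ.≤-trans (swap-deg x∈ y∉ nd) leaf)))
      where
      at : ∀ {z} → z ∈ F → z ≢ x → y ~ z → nbrs (delete F x) y z ≡ true
      at z∈ z≢x yz rewrite delete-∈ {F} z∈ z≢x | ~⇒≡true yz = refl

    deg≤1 : ∀ {x} → x ∈ F → (∀ {a b} → a ∈ F → b ∈ F → x ~ a → x ~ b → a ≢ b → Reach (λ v → v ∈ F × x ≢ v) a b) →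
            deg (delete F x) x ≤ 1
    deg≤1 {x} x∈ conn = count≤1 _ one
      where
      one : ∀ {a b} → nbrs (delete F x) x a ≡ true → nbrs (delete F x) x b ≡ true → a ≡ b
      one {a} {b} p q with a Fin.≟ b
      ... | yes eq = eq
      ... | no ne with delete F x a in a∈ | delete F x b in b∈
      ...   | true | true = ⊥-elim (acyclic ext (double⇒cyclic x∈
                (a , b , ne , ≡true⇒~ p , ≡true⇒~ q ,
                 conn (proj₁ (delete-∈⁻ {F} a∈)) (proj₁ (delete-∈⁻ {F} b∈)) (≡true⇒~ p) (≡true⇒~ q) ne)))

  -- The invariant between two components

  Closed : VSet → VSet → Set
  Closed F P = ∀ {x y} → x ∈ F → y ∈ F → x ~ y → x ∈ P → y ∈ P

  closed-reach : ∀ {F P a b} → Closed F P → Reach (_∈ F) a b → a ∈ P → b ∈ P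
  closed-reach cl (here _) a∈ = a∈
  closed-reach cl (step s e r) a∈ = closed-reach cl r (cl s (source r) e a∈)

  -- This places the component in which an unplaced outside vertex has two neighbours outside `P`,
  -- so that entering through that vertex always makes progress in `F`.
  NoDouble : VSet → VSet → Set
  NoDouble F P = ∀ {y a b} → y ∉ F → y ∉ P → a ≢ b → y ~ a → y ~ b → Reach (_∈ F) a b → a ∈ P → ⊥

  record Complete (F P : VSet) : Set₁ where
    field
      closed   : Closed F P
      noDouble : NoDouble F P
      {U}      : V → Set
      state    : State P (λ _ → ⊥) U (λ _ → ⊥)
      U⊆       : ∀ {x} → U x → x ∈ F × x ∈ P

  infix 4 _⊏_
  _⊏_ : VSet → VSet → Set
  P ⊏ P′ = (∀ {x} → x ∈ P → x ∈ P′) × ∃[ z ] (z ∈ P′ × z ∉ P)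

  ⊏-⊆ : ∀ {P P′ P″} → P ⊏ P′ → (∀ {x} → x ∈ P′ → x ∈ P″) → P ⊏ P″
  ⊏-⊆ (sub , z , z∈ , z∉) f = f ∘ sub , z , f z∈ , z∉

  remaining : VSet → ℕ
  remaining P = count (not ∘ P)

  remaining-⊏ : ∀ {P P′} → P ⊏ P′ → remaining P′ < remaining P
  remaining-⊏ {P} {P′} (sub , z , z∈ , z∉) =
    count-mono-< (not ∘ P′) (not ∘ P) {z} (λ v m → ∉⇒not (not⇒∉ m)) (cong not z∈) (cong not z∉)
    where
    ∉⇒not : ∀ {v} → v ∉ P′ → not (P v) ≡ true
    ∉⇒not {v} m with dec∈ P v
    ... | inj₁ p = ⊥-elim (∈∉⊥ {P′} (sub p) m)
    ... | inj₂ p rewrite p = refl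
    not⇒∉ : ∀ {b} → not b ≡ true → b ≡ false
    not⇒∉ {false} _ = refl

  insert-⊏ : ∀ {P x} → x ∉ P → P ⊏ insert P x
  insert-⊏ {P} {x} x∉ = insert-old {P} , x , insert-self {P} , x∉

  -- Placing one component with its outside vertices

  module Block (F P₀ : VSet) (ext : Extremal F) (closed₀ : Closed F P₀) (noDouble₀ : NoDouble F P₀)
               (K : ∀ {P} → Complete F P → P₀ ⊏ P → ⊥) where

    -- P₀ is the placed set before the current component is started.
    Core : VSet → V → Set
    Core P x = x ∈ F × x ∈ P × x ∉ P₀

    record Partial (P : VSet) (C U : V → Set) (L : Bool → Set) : Set where
      field
        st     : State P C U L
        grows  : P₀ ⊏ P
        core⊆C : ∀ {x} → Core P x → C x
        U⊆     : ∀ {x} → U x → x ∈ F × x ∈ P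

    open Partial

    complete : ∀ {P C U L} → Partial P C U L → Closed F P →
               (∀ {y a b} → y ∉ F → y ∉ P → a ≢ b → y ~ a → y ~ b → Core P a → Core P b → ⊥) → ⊥
    complete {P} pt closed none = K (record
      { closed = closed
      ; noDouble = noDouble
      ; state = forget (st pt)
      ; U⊆ = U⊆ pt }) (grows pt)
      where
      noDouble : NoDouble F P
      noDouble {y} {a} {b} y∉F y∉P a≢b ya yb r a∈ with dec∈ P₀ a | dec∈ P₀ b | dec∈ P₀ y
      ... | _ | _ | inj₁ y∈₀ = ∈∉⊥ {P} (proj₁ (grows pt) y∈₀) y∉P
      ... | inj₁ a∈₀ | _ | inj₂ y∉₀ = noDouble₀ y∉F y∉₀ a≢b ya yb r a∈₀
      ... | inj₂ a∉₀ | inj₁ b∈₀ | inj₂ _ = ∈∉⊥ {P₀} (closed-reach {F} {P₀} closed₀ (reach-sym r) b∈₀) a∉₀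
      ... | inj₂ a∉₀ | inj₂ b∉₀ | inj₂ _ =
        none y∉F y∉P a≢b ya yb (source r , a∈ , a∉₀) (target r , closed-reach {F} {P} closed r a∈ , b∉₀)

    fringe-core : ∀ {P x a} → P₀ ⊏ P → x ∈ F → x ∉ P → a ∈ F → a ∈ P → a ~ x → Core P a
    fringe-core {P} {x} {a} gr x∈F x∉P a∈F a∈P ax with dec∈ P₀ a
    ... | inj₁ a∈₀ = ⊥-elim (∈∉⊥ {P} (proj₁ gr (closed₀ a∈F x∈F ax a∈₀)) x∉P)
    ... | inj₂ a∉₀ = a∈F , a∈P , a∉₀

    leaf : ∀ {P C U L x a} → Partial P C U L → x ∈ F → x ∉ P → Core P a → a ~ x →
           Partial (insert P x) (C ⊕ x) (U ⊕ x) L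
    leaf {P} {C} pt x∈F x∉P ca ax = record
      { st = leafStep (st pt) x∉P (core⊆C pt ca) (~-sym ax) (λ u → ∈∉⊥ {P} (proj₂ (U⊆ pt u)) x∉P)
      ; grows = ⊏-⊆ (grows pt) (insert-old {P})
      ; core⊆C = λ (zF , zP , z∉) → Sum.map₁ (λ zP → core⊆C pt (zF , zP , z∉)) (insert-split {P} zP)
      ; U⊆ = λ { (inj₁ u) → proj₁ (U⊆ pt u) , insert-old {P} (proj₂ (U⊆ pt u)) ; (inj₂ refl) → x∈F , insert-self {P} } }

    -- The core may span two components, and the two neighbours may then lie in different ones. Such
    -- vertices are hung as well; only those with both neighbours in one component have to be.
    TwoCore : VSet → V → Set
    TwoCore P y = ∃[ a ] ∃[ b ] (a ≢ b × y ~ a × y ~ b × Core P a × Core P b)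

    -- With a spare name `s` the last leaf need not share its name: every forest vertex is hung
    -- under its own name, and `s` hangs the outside vertices. Each of these then has two neighbours
    -- in `C`, so no pair has to be adjacent.
    finishSpare : ∀ k {P C U L s} → Partial P C U L → ¬ L true → s ∈ F → s ∈ P → ¬ U s → remaining P ≤ k → ⊥
    finishSpare k {P} {C} {U} {L} {s} pt L-true s∈F s∈P s∉U bound =
      em (λ (x , a , x∈F , x∉P , a∈F , a∈P , ax) → go k bound x∈F x∉P a∈F a∈P ax)
         (λ stuck → finish (λ {x} {y} x∈F y∈F xy x∈P → notStuck stuck x∈F y∈F xy x∈P))
      where
      go : ∀ k → remaining P ≤ k → ∀ {x a} → x ∈ F → x ∉ P → a ∈ F → a ∈ P → a ~ x → ⊥
      go zero bound {x} x∈F x∉P _ _ _ = ℕ.<⇒≱ (count≥1 (not ∘ P) {x} (cong not x∉P)) bound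
      go (suc k) bound x∈F x∉P a∈F a∈P ax =
        finishSpare k (leaf pt x∈F x∉P (fringe-core {P} (grows pt) x∈F x∉P a∈F a∈P ax) ax) L-true s∈F (insert-old {P} s∈P)
          (λ { (inj₁ u) → s∉U u ; (inj₂ refl) → ∈∉⊥ {P} s∈P x∉P })
          (ℕ.≤-pred (ℕ.≤-trans (remaining-⊏ (insert-⊏ {P} x∉P)) bound))
      notStuck : ¬ (∃[ x ] ∃[ a ] (x ∈ F × x ∉ P × a ∈ F × a ∈ P × a ~ x)) → Closed F P
      notStuck stuck {x} {y} x∈F y∈F xy x∈P with dec∈ P y
      ... | inj₁ y∈P = y∈P
      ... | inj₂ y∉P = ⊥-elim (stuck (y , x , y∈F , y∉P , x∈F , x∈P , xy))
      finish : Closed F P → ⊥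
      finish closed = decAll (λ y → y ∉ F × y ∉ P × TwoCore P y) λ d →
        let
          N : VSet
          N y = does (d y)
          N⇒ : ∀ {y} → y ∈ N → y ∉ F × y ∉ P × TwoCore P y
          N⇒ {y} m = witness (d y) m
          anchor : V → V
          anchor y = pick (d y)
          st′ = outerStep (st pt) N (λ m → proj₁ (proj₂ (N⇒ m))) anchor (λ {y} m → anchor-ok (d y) m) s∉U {true} L-true
                  (λ {_} {y} _ m _ → inj₂ (inj₂ (second (d y) m)))
          N∩F : ∀ {y} → y ∈ P ∪ N → y ∈ F → y ∈ P
          N∩F {y} m y∈F = Sum.[ id , (λ m → ⊥-elim (∈∉⊥ {F} y∈F (proj₁ (N⇒ {y} m)))) ]′ (∪-split {P} {N} m)
        in complete (record
             { st = st′
             ; grows = ⊏-⊆ (grows pt) (∪ˡ {P} {N})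
             ; core⊆C = λ (zF , zP , z∉) → inj₁ (core⊆C pt (zF , N∩F zP zF , z∉))
             ; U⊆ = λ { (inj₁ u) → proj₁ (U⊆ pt u) , ∪ˡ {P} {N} (proj₂ (U⊆ pt u)) ; (inj₂ refl) → s∈F , ∪ˡ {P} {N} s∈P } })
             (λ x∈F y∈F xy x∈ → ∪ˡ {P} {N} (closed x∈F y∈F xy (N∩F x∈ x∈F)))
             (λ {y} y∉F y∉ a≢b ya yb (aF , aP , a∉) (bF , bP , b∉) →
                refute (d y) (y∉F , proj₁ (∪-∉⁻ {P} {N} y∉) , _ , _ , a≢b , ya , yb , (aF , N∩F aP aF , a∉) , (bF , N∩F bP bF , b∉))
                  (proj₂ (∪-∉⁻ {P} {N} y∉)))
        where
        ∪-∉⁻ : ∀ {S S′ : VSet} {x} → x ∉ S ∪ S′ → x ∉ S × x ∉ S′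
        ∪-∉⁻ {S} {S′} {x} m with S x
        ... | false = refl , m
        witness : ∀ {A : Set} (d : Dec A) → does d ≡ true → A
        witness (yes a) _ = a
        refute : ∀ {A : Set} (d : Dec A) → A → does d ≡ false → ⊥
        refute (no ¬a) a _ = ¬a a
        pick : ∀ {y} → Dec (y ∉ F × y ∉ P × TwoCore P y) → V
        pick (yes (_ , _ , a , _)) = a
        pick {y} (no _) = y
        anchor-ok : ∀ {y} (d : Dec (y ∉ F × y ∉ P × TwoCore P y)) → does d ≡ true → C (pick d) × y ~ pick d
        anchor-ok (yes (_ , _ , a , b , _ , ya , _ , ca , _)) _ = core⊆C pt ca , ya
        second : ∀ {y} (d : Dec (y ∉ F × y ∉ P × TwoCore P y)) → does d ≡ true → ∃[ z ] (C z × z ≢ pick d × y ~ z)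
        second (yes (_ , _ , a , b , a≢b , _ , yb , _ , cb)) _ = b , core⊆C pt cb , a≢b ∘ sym , yb

    CoreConnected : VSet → Set
    CoreConnected P = ∀ {x y} → Core P x → Core P y → Reach (Core P) x y

    -- The name `p₀` may be in use before the vertex `p₀` is placed, namely when it colours the edge
    -- that led to the ear.
    earPartial : ∀ {P C U L New p₀} (e : Ear P C U L New p₀) → P₀ ⊏ P → (∀ {x} → Core P x → C x) → (∀ {x} → New x → x ∈ F) →
                 New p₀ → (∀ {x} → U x → x ∈ F × (x ∈ P ⊎ x ≡ p₀)) → Partial (Ear.P″ e) (Ear.C″ e) (Ear.U″ e) L
    earPartial {P} e gr core⊆ New⊆F Np₀ U⊆ = record
      { st = state
      ; grows = ⊏-⊆ gr P⊆P″
      ; core⊆C = λ (xF , xP , x∉) → Sum.[ (λ xP → C⊆C″ (core⊆ (xF , xP , x∉))) , New⊆C″ ]′ (P″⊆ xP)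
      ; U⊆ = λ u → Sum.[ (λ u → proj₁ (U⊆ u) , Sum.[ P⊆P″ , (λ { refl → C⊆P state (New⊆C″ Np₀) }) ]′ (proj₂ (U⊆ u)))
                       , (λ (m , _) → New⊆F m , C⊆P state (New⊆C″ m)) ]′ (U″⊆ u) }
      where open Ear e

    module Final {P C U} (pt : Partial P C U (λ _ → ⊥)) (conn : CoreConnected P)
                 {ℓ p} (ℓ∈F : ℓ ∈ F) (ℓ∉P : ℓ ∉ P) (cp : Core P p) (pℓ : p ~ ℓ) (closed : Closed F (insert P ℓ)) where

      -- For y ∉ P: two neighbours of y in the component completed by ℓ, the first of them different from ℓ.
      NB : V → Set
      NB y = ∃[ a ] (Core P a × y ~ a × ((∃[ b ] (Core P b × b ≢ a × y ~ b)) ⊎ y ~ ℓ))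

      Multi : Set
      Multi = ∃[ y ] (y ∉ F × y ∉ P × NB y × ∃[ a ] ∃[ b ] (a ≢ b × y ~ a × y ~ b × Reach (_∈ F) a b × a ∉ insert P ℓ))

      ∉P⇒∉P₀ : ∀ {y} → y ∉ P → y ∉ P₀
      ∉P⇒∉P₀ {y} m with dec∈ P₀ y
      ... | inj₁ k = ⊥-elim (∈∉⊥ {P} (proj₁ (grows pt) k) m)
      ... | inj₂ k = k

      core-insert : ∀ {x} → Core (insert P ℓ) x → Core P x ⊎ x ≡ ℓ
      core-insert (xF , xP , x∉) = Sum.map₁ (λ xP → xF , xP , x∉) (insert-split {P} xP)

      twoCore⇒NB : ∀ {y} → TwoCore (insert P ℓ) y → NB y
      twoCore⇒NB (a , b , a≢b , ya , yb , ca , cb) with core-insert ca | core-insert cb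
      ... | inj₁ ca | inj₁ cb = a , ca , ya , inj₁ (b , cb , a≢b ∘ sym , yb)
      ... | inj₁ ca | inj₂ refl = a , ca , ya , inj₂ yb
      ... | inj₂ refl | inj₁ cb = b , cb , yb , inj₂ ya
      ... | inj₂ refl | inj₂ refl = ⊥-elim (a≢b refl)

      core-reach : ∀ {a b} → Core P a → Reach (_∈ F) a b → b ≢ ℓ → Core P b
      core-reach {a} {b} (aF , aP , a∉) r b≢ℓ with insert-split {P} (closed-reach {F} {insert P ℓ} closed r (insert-old {P} aP)) | dec∈ P₀ b
      ... | inj₂ eq | _ = ⊥-elim (b≢ℓ eq)
      ... | inj₁ bP | inj₂ b∉ = target r , bP , b∉
      ... | inj₁ bP | inj₁ b∈ = ⊥-elim (∈∉⊥ {P₀} (closed-reach {F} {P₀} closed₀ (reach-sym r) b∈) a∉)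

      -- The component without ℓ is already connected, so two neighbours of ℓ would close a cycle.
      ℓ-leaf : deg (delete F ℓ) ℓ ≤ 1
      ℓ-leaf = deg≤1 ext ℓ∈F λ a∈ b∈ ℓa ℓb _ →
        reach-mono (λ (xF , xP , _) → xF , λ { refl → ∈∉⊥ {P} xP ℓ∉P }) (conn (nbr a∈ ℓa) (nbr b∈ ℓb))
        where
        nbr : ∀ {a} → a ∈ F → ℓ ~ a → Core P a
        nbr a∈ ℓa with insert-split {P} (closed ℓ∈F a∈ ℓa (insert-self {P}))
        ... | inj₁ aP = fringe-core {P} (grows pt) ℓ∈F ℓ∉P a∈ aP (~-sym ℓa)
        ... | inj₂ refl = ⊥-elim (~⇒≢ ℓa refl)

      Pendant : V → V → Set
      Pendant y a = y ∉ F × y ∉ P × Core P a × y ~ a × y ~ ℓ × (∀ {b} → Core P b → y ~ b → b ≡ a)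

      module _ (single : ¬ Multi) where

        -- Two such neighbours would lie in an older component, against `noDouble₀`, in the current
        -- one, where both equal `a`, or in an unplaced one, which is the case `Multi`.
        pendant-noDouble : ∀ {y a} → Pendant y a → ¬ Double (_∈ delete F ℓ) y
        pendant-noDouble {y} {a} (y∉F , y∉P , ca , ya , yℓ , only) (a′ , b′ , ne , ya′ , yb′ , r) = go (dec∈ P a′) (dec∈ P₀ a′)
          where
          r′ : Reach (_∈ F) a′ b′
          r′ = reach-mono (proj₁ ∘ delete-∈⁻ {F}) r
          go : a′ ∈ P ⊎ a′ ∉ P → a′ ∈ P₀ ⊎ a′ ∉ P₀ → ⊥
          go _ (inj₁ a∈₀) = noDouble₀ y∉F (∉P⇒∉P₀ y∉P) ne ya′ yb′ r′ a∈₀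
          go (inj₁ a∈P) (inj₂ a∉₀) =
            let ca′ = source r′ , a∈P , a∉₀ in
            ne (trans (only ca′ ya′) (sym (only (core-reach ca′ r′ (proj₂ (delete-∈⁻ {F} (target r)))) yb′)))
          go (inj₂ a∉P) (inj₂ _) =
            single (y , y∉F , y∉P , (a , ca , ya , inj₂ yℓ) , a′ , b′ , ne , ya′ , yb′ , r′ ,
                    insert-∉ {P} a∉P (proj₂ (delete-∈⁻ {F} (source r))))

        -- Here density enters: ℓ is a leaf, so a vertex that may replace it has at most one
        -- neighbour in F - ℓ, even counting all other components.
        pendant-nbr : ∀ {y a b} → Pendant y a → b ∈ delete F ℓ → y ~ b → b ≡ a
        pendant-nbr {y} {a} {b} pd@(y∉F , y∉P , ca@(aF , aP , _) , ya , _) b∈ yb =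
          swap-single ext ℓ∈F y∉F (pendant-noDouble pd) ℓ-leaf
            (proj₁ (delete-∈⁻ {F} b∈)) (proj₂ (delete-∈⁻ {F} b∈)) yb aF (λ { refl → ∈∉⊥ {P} aP ℓ∉P }) ya

        -- Otherwise ℓ could be exchanged for both y and y′.
        pendants-adjacent : ∀ {y y′ a a′} → Pendant y a → Pendant y′ a′ → y ≢ y′ → ¬ y ~ y′ → ⊥
        pendants-adjacent {y} {y′} {a} {a′} pd pd′ y≢y′ nadj =
          ℕ.<-irrefl (swap-size ext ℓ∈F (proj₁ pd)) (subst (_≤ f) (count-insert F₁ y′∉) (maxf _ (insert-acyclic {F₁}
            (insert-acyclic {delete F ℓ} (delete-acyclic {F} (acyclic ext)) (pendant-noDouble pd)) nd)))
          where
          F₁ : VSet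
          F₁ = insert (delete F ℓ) y
          y′∉ : y′ ∉ F₁
          y′∉ = insert-∉ {delete F ℓ} (cong (_∧ not (y′ == ℓ)) (proj₁ pd′)) (y≢y′ ∘ sym)
          toA : ∀ {b} → b ∈ F₁ → y′ ~ b → b ≡ a′
          toA b∈ yb with insert-split {delete F ℓ} b∈
          ... | inj₁ b∈ = pendant-nbr pd′ b∈ yb
          ... | inj₂ refl = ⊥-elim (nadj (~-sym yb))
          nd : ¬ Double (_∈ F₁) y′
          nd (b , c , ne , yb , yc , r) = ne (trans (toA (source r) yb) (sym (toA (target r) yc)))

        finishSingle : ⊥
        finishSingle = decAll Outer λ d → decAll (Second d) λ e → go d e
          where
          Outer : V → Set
          -- The leaf ℓ joins the outside vertices, because its anchor edge and theirs share the
          -- name ℓ.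
          Outer y = y ≡ ℓ ⊎ (y ∉ F × y ∉ P × NB y)
          anchor : ∀ {y} → Dec (Outer y) → V
          anchor (yes (inj₁ _)) = p
          anchor (yes (inj₂ (_ , _ , a , _))) = a
          anchor {y} (no _) = y
          Second : (∀ y → Dec (Outer y)) → V → Set
          Second d y = ∃[ b ] (Core P b × b ≢ anchor (d y) × y ~ b)
          go : (d : ∀ y → Dec (Outer y)) → (∀ y → Dec (Second d y)) → ⊥
          go d e = complete (record
             { st = outerStep (st pt) N N∩P (λ y → anchor (d y)) (λ {y} m → core⊆C pt (proj₁ (anchor-ok y m)) , proj₂ (anchor-ok y m))
                      (λ u → ∈∉⊥ {P} (proj₂ (U⊆ pt u)) ℓ∉P) {true} (λ ()) pairs
             ; grows = ⊏-⊆ (grows pt) (∪ˡ {P} {N})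
             ; core⊆C = λ (zF , zP , z∉) → Sum.map (λ zP → core⊆C pt (zF , zP , z∉)) (λ { refl → ℓ∈N }) (toInsert zP zF)
             ; U⊆ = λ { (inj₁ u) → proj₁ (U⊆ pt u) , ∪ˡ {P} {N} (proj₂ (U⊆ pt u)) ; (inj₂ refl) → ℓ∈F , ∪ʳ {P} {N} ℓ∈N } })
             (λ x∈F y∈F xy x∈ → fromInsert (closed x∈F y∈F xy (toInsert′ x∈ x∈F)))
             (λ {y} {a} {b} y∉F y∉ a≢b ya yb (aF , aP , a∉) (bF , bP , b∉) →
                ∈∉⊥ {N} (complete-∈ (inj₂ (y∉F , ∉-left y∉ , twoCore⇒NB (a , b , a≢b , ya , yb , (aF , toInsert′ aP aF , a∉) , (bF , toInsert′ bP bF , b∉)))))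
                  (∉-right y∉))
            where
            N : VSet
            N y = does (d y)
            sound : ∀ {y} → y ∈ N → Outer y
            sound {y} m with d y
            ... | yes o = o
            complete-∈ : ∀ {y} → Outer y → y ∈ N
            complete-∈ {y} o with d y
            ... | yes _ = refl
            ... | no ¬o = ⊥-elim (¬o o)
            ∉-left : ∀ {y} → y ∉ P ∪ N → y ∉ P
            ∉-left {y} m with P y
            ... | false = refl
            ∉-right : ∀ {y} → y ∉ P ∪ N → y ∉ N
            ∉-right {y} m with P y
            ... | false = m
            ℓ∈N : ℓ ∈ N
            ℓ∈N = complete-∈ (inj₁ refl)
            N∩P : ∀ {y} → y ∈ N → y ∉ P
            N∩P {y} m with sound {y} m
            ... | inj₁ refl = ℓ∉P
            ... | inj₂ (_ , y∉ , _) = y∉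
            toInsert : ∀ {y} → y ∈ P ∪ N → y ∈ F → y ∈ P ⊎ y ≡ ℓ
            toInsert {y} m y∈F with ∪-split {P} {N} m
            ... | inj₁ yP = inj₁ yP
            ... | inj₂ yN with sound {y} yN
            ...   | inj₁ eq = inj₂ eq
            ...   | inj₂ (y∉F , _) = ⊥-elim (∈∉⊥ {F} y∈F y∉F)
            toInsert′ : ∀ {y} → y ∈ P ∪ N → y ∈ F → y ∈ insert P ℓ
            toInsert′ m y∈F with toInsert m y∈F
            ... | inj₁ yP = insert-old {P} yP
            ... | inj₂ refl = insert-self {P}
            fromInsert : ∀ {y} → y ∈ insert P ℓ → y ∈ P ∪ N
            fromInsert m with insert-split {P} m
            ... | inj₁ yP = ∪ˡ {P} {N} yP
            ... | inj₂ refl = ∪ʳ {P} {N} ℓ∈N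
            anchor-ok : ∀ y → y ∈ N → Core P (anchor (d y)) × y ~ anchor (d y)
            anchor-ok y m with d y
            ... | yes (inj₁ refl) = cp , ~-sym pℓ
            ... | yes (inj₂ (_ , _ , _ , ca , ya , _)) = ca , ya
            pendant : ∀ {y} → y ∈ N → ¬ Second d y → y ≡ ℓ ⊎ Pendant y (anchor (d y))
            pendant {y} m ¬s with d y
            ... | yes (inj₁ eq) = inj₁ eq
            ... | yes (inj₂ (_ , _ , a , ca , ya , inj₁ s)) = ⊥-elim (¬s s)
            ... | yes (inj₂ (y∉F , y∉P , a , ca , ya , inj₂ yℓ)) = inj₂ (y∉F , y∉P , ca , ya , yℓ , only)
              where
              only : ∀ {b} → Core P b → y ~ b → b ≡ a
              only {b} cb yb with b Fin.≟ a
              ... | yes eq = eq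
              ... | no ne = ⊥-elim (¬s (b , cb , ne , yb))
            inC : ∀ {y} → Second d y → ∃[ z ] (C z × z ≢ anchor (d y) × y ~ z)
            inC (b , cb , ne , yb) = b , core⊆C pt cb , ne , yb
            pairs : ∀ {x y} → x ∈ N → y ∈ N → x ≢ y →
                    x ~ y ⊎ (∃[ z ] (C z × z ≢ anchor (d x) × x ~ z)) ⊎ (∃[ z ] (C z × z ≢ anchor (d y) × y ~ z))
            pairs {x} {y} x∈ y∈ x≢y with e x | e y
            ... | yes s | _ = inj₂ (inj₁ (inC s))
            ... | no _ | yes s = inj₂ (inj₂ (inC s))
            ... | no ¬s | no ¬s′ with pendant {x} x∈ ¬s | pendant {y} y∈ ¬s′
            ...   | inj₁ refl | inj₁ refl = ⊥-elim (x≢y refl)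
            -- A vertex without a second neighbour in the core got into `N` by its adjacency to ℓ.
            ...   | inj₁ refl | inj₂ (_ , _ , _ , _ , yℓ , _) = inj₁ (~-sym yℓ)
            ...   | inj₂ (_ , _ , _ , _ , xℓ , _) | inj₁ refl = inj₁ xℓ
            ...   | inj₂ pd | inj₂ pd′ with adj x y in eq
            ...     | true = inj₁ tt
            ...     | false = ⊥-elim (pendants-adjacent pd pd′ x≢y (λ xy → subst T eq xy))

      -- Hanging ℓ and y together spends the name ℓ once; an ear at y through the other component
      -- then leaves the name `a′` spare.
      finishMulti : Multi → ⊥
      finishMulti (y , y∉F , y∉P , (a , ca , ya , second) , a′ , b′ , ne , ya′ , yb′ , r , a′∉) =
        finishSpare (remaining (Ear.P″ e)) pt′ (λ { (inj₁ ()) ; (inj₂ ()) }) (source r)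
          (proj₂ (proj₂ (New⊆ (head∈ path)))) spare ℕ.≤-refl
        where
        y≢ℓ : y ≢ ℓ
        y≢ℓ refl = ∈∉⊥ {F} ℓ∈F y∉F
        N : VSet
        N v = (v == ℓ) ∨ (v == y)
        N⇒ : ∀ {v} → v ∈ N → v ≡ ℓ ⊎ v ≡ y
        N⇒ {v} m = Sum.map ==-true ==-true (∪-split {_== ℓ} {_== y} {v} m)
        ℓ∈N : ℓ ∈ N
        ℓ∈N = ∪ˡ {_== ℓ} {_== y} {ℓ} (==-refl ℓ)
        y∈N : y ∈ N
        y∈N = ∪ʳ {_== ℓ} {_== y} {y} (==-refl y)
        anchor : V → V
        anchor v = if v == ℓ then p else a
        anchor-ℓ : anchor ℓ ≡ p
        anchor-ℓ rewrite ==-refl ℓ = refl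
        anchor-y : anchor y ≡ a
        anchor-y rewrite ==-false y≢ℓ = refl
        anchor-ok : ∀ {v} → v ∈ N → C (anchor v) × v ~ anchor v
        anchor-ok {v} m with N⇒ {v} m
        ... | inj₁ refl rewrite anchor-ℓ = core⊆C pt cp , ~-sym pℓ
        ... | inj₂ refl rewrite anchor-y = core⊆C pt ca , ya
        N∩P : ∀ {v} → v ∈ N → v ∉ P
        N∩P {v} m with N⇒ {v} m
        ... | inj₁ refl = ℓ∉P
        ... | inj₂ refl = y∉P
        second′ : y ~ ℓ ⊎ ∃[ z ] (C z × z ≢ anchor y × y ~ z)
        second′ = Sum.swap (Sum.map₁ (λ (b , cb , b≢a , yb) → b , core⊆C pt cb , subst (b ≢_) (sym anchor-y) b≢a , yb) second)
        pairs : ∀ {x z} → x ∈ N → z ∈ N → x ≢ z →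
                x ~ z ⊎ (∃[ b ] (C b × b ≢ anchor x × x ~ b)) ⊎ (∃[ b ] (C b × b ≢ anchor z × z ~ b))
        pairs {x} {z} x∈ z∈ x≢z with N⇒ {x} x∈ | N⇒ {z} z∈
        ... | inj₁ refl | inj₁ refl = ⊥-elim (x≢z refl)
        ... | inj₂ refl | inj₂ refl = ⊥-elim (x≢z refl)
        ... | inj₁ refl | inj₂ refl = Sum.map ~-sym inj₂ second′
        ... | inj₂ refl | inj₁ refl = Sum.map₂ inj₁ second′
        st′ : State (P ∪ N) (λ x → C x ⊎ x ∈ N) (U ⊕ ℓ) (λ b → ⊥ ⊎ b ≡ false)
        -- The link between ℓ and y takes the extra colour `false`, since `finishSpare` still needs
        -- `true`.
        st′ = outerStep (st pt) N (λ {v} → N∩P {v}) anchor (λ {v} → anchor-ok {v}) (λ u → ∈∉⊥ {P} (proj₂ (U⊆ pt u)) ℓ∉P) {false} (λ ()) (λ {x} {z} → pairs {x} {z})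
        path′ = reach⇒path r
        path = proj₁ path′
        path⊆F : ∀ {v} → v ∈ᴸ vertices G path → v ∈ F
        path⊆F = All.lookup (proj₂ (proj₂ path′))
        unplaced : ∀ {v} → v ∈ᴸ vertices G path → v ∉ insert P ℓ
        unplaced {v} m with dec∈ (insert P ℓ) v
        ... | inj₂ v∉ = v∉
        ... | inj₁ v∈ = ⊥-elim (∈∉⊥ {insert P ℓ}
                (closed-reach {F} {insert P ℓ} closed (reach-sym (reach-mono path⊆F (reach-vertex path m))) v∈) a′∉)
        unplaced′ : ∀ {v} → v ∈ᴸ vertices G path → v ∉ P ∪ N
        unplaced′ {v} m = let v∉P , v≢ℓ = insert-∉⁻ {P} (unplaced m) in
          ∪-∉ {P} {N} v∉P (∪-∉ {_== ℓ} {_== y} {v} (==-false v≢ℓ) (==-false {i = v} {y} (λ { refl → ∈∉⊥ {F} (path⊆F m) y∉F })))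
        U′⊆ : ∀ {x} → (U ⊕ ℓ) x → x ∈ F × x ∈ P ∪ N
        U′⊆ (inj₁ u) = proj₁ (U⊆ pt u) , ∪ˡ {P} {N} (proj₂ (U⊆ pt u))
        U′⊆ (inj₂ refl) = ℓ∈F , ∪ʳ {P} {N} ℓ∈N
        e : Ear (P ∪ N) (λ x → C x ⊎ x ∈ N) (U ⊕ ℓ) (λ b → ⊥ ⊎ b ≡ false) (_∈ᴸ vertices G path) a′
        e = ear st′ (inj₂ y∈N) (~-sym ya′) (~-sym yb′) ne path (proj₁ (proj₂ path′)) unplaced′
              (λ m _ u → ∈∉⊥ {P ∪ N} (proj₂ (U′⊆ u)) (unplaced′ m))
        New⊆ : ∀ {v} → v ∈ᴸ vertices G path → v ∈ F × v ∉ P × v ∈ Ear.P″ e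
        New⊆ m = path⊆F m , proj₁ (insert-∉⁻ {P} (unplaced m)) , C⊆P (Ear.state e) (Ear.New⊆C″ e m)
        pt′ = earPartial e (⊏-⊆ (grows pt) (∪ˡ {P} {N}))
                (λ { {x} (xF , xP , x∉) → Sum.map₁ (λ xP → core⊆C pt (xF , xP , x∉)) (∪-split {P} {N} xP) })
                path⊆F (head∈ path) (λ u → proj₁ (U′⊆ u) , inj₁ (proj₂ (U′⊆ u)))
        spare : ¬ Ear.U″ e a′
        spare u with Ear.U″⊆ e u
        ... | inj₁ u = ∈∉⊥ {P ∪ N} (proj₂ (U′⊆ u)) (unplaced′ (head∈ path))
        ... | inj₂ (_ , ne) = ne refl

      final : ⊥
      final = em finishMulti finishSingle

    loop : ∀ k {P C U} → Partial P C U (λ _ → ⊥) → CoreConnected P → remaining P ≤ k →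
           ∀ {x a} → x ∈ F → x ∉ P → a ∈ F → a ∈ P → a ~ x → ⊥
    loop zero {P} pt conn bound {x} x∈F x∉P _ _ _ = ℕ.<⇒≱ (count≥1 (not ∘ P) {x} (cong not x∉P)) bound
    loop (suc k) {P} pt conn bound {x} {a} x∈F x∉P a∈F a∈P ax =
      em {Closed F (insert P x)} (λ closed → Final.final pt conn x∈F x∉P ca ax closed)
         -- If x is not the last vertex of its component, any edge leaving the enlarged set supplies
         -- the next leaf, and the recursion on it is absurd; so the set would be closed after all.
         (λ ¬closed → ¬closed (λ {y} {z} y∈F z∈F yz y∈ → next y∈F z∈F yz y∈))
      where
      ca : Core P a
      ca = fringe-core {P} (grows pt) x∈F x∉P a∈F a∈P ax
      core-old : ∀ {z} → Core P z → Core (insert P x) z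
      core-old (zF , zP , z∉) = zF , insert-old {P} zP , z∉
      toAnchor : ∀ {z} → Core (insert P x) z → Reach (Core (insert P x)) z a
      toAnchor cz@(zF , zP , z∉) with insert-split {P} zP
      ... | inj₁ zP = reach-mono core-old (conn (zF , zP , z∉) ca)
      ... | inj₂ refl = step cz (~-sym ax) (here (core-old ca))
      next : ∀ {y z} → y ∈ F → z ∈ F → y ~ z → y ∈ insert P x → z ∈ insert P x
      next {y} {z} y∈F z∈F yz y∈ with dec∈ (insert P x) z
      ... | inj₁ z∈ = z∈
      ... | inj₂ z∉ = ⊥-elim (loop k (leaf pt x∈F x∉P ca ax) (λ cy cz → toAnchor cy ◅◅ reach-sym (toAnchor cz))
                        (ℕ.≤-pred (ℕ.≤-trans (remaining-⊏ (insert-⊏ {P} x∉P)) bound)) z∈F z∉ y∈F y∈ yz)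

    start : ∀ {P C U} → Partial P C U (λ _ → ⊥) → CoreConnected P → (Closed F P → ⊥) → ⊥
    start {P} pt conn whole = whole λ {x} {y} x∈F y∈F xy x∈P → go x∈F y∈F xy x∈P
      where
      go : ∀ {x y} → x ∈ F → y ∈ F → x ~ y → x ∈ P → y ∈ P
      go {x} {y} x∈F y∈F xy x∈P with dec∈ P y
      ... | inj₁ y∈P = y∈P
      ... | inj₂ y∉P = ⊥-elim (loop (remaining P) pt conn ℕ.≤-refl y∈F y∉P x∈F x∈P xy)

    root : ∀ {U r} → r ∈ F → r ∉ P₀ → State (insert P₀ r) (_≡ r) U (λ _ → ⊥) → (∀ {x} → U x → x ∈ F × x ∈ insert P₀ r) → ⊥
    root {U} {r} r∈F r∉P₀ state U⊆ = start pt conn λ closed →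
      -- The component is r alone, and no vertex has two neighbours in it.
      complete pt closed (λ _ _ a≢b _ _ ca cb → a≢b (trans (core≡ ca) (sym (core≡ cb))))
      where
      core≡ : ∀ {x} → Core (insert P₀ r) x → x ≡ r
      core≡ (_ , xP , x∉) with insert-split {P₀} xP
      ... | inj₁ x∈ = ⊥-elim (∈∉⊥ {P₀} x∈ x∉)
      ... | inj₂ eq = eq
      pt : Partial (insert P₀ r) (_≡ r) U (λ _ → ⊥)
      pt = record { st = state ; grows = insert-⊏ {P₀} r∉P₀ ; core⊆C = core≡ ; U⊆ = U⊆ }
      conn : CoreConnected (insert P₀ r)
      conn cx cy with core≡ cx | core≡ cy
      ... | refl | refl = here cx

    attachRoot : ∀ {U v r} → State P₀ (λ _ → ⊥) U (λ _ → ⊥) → (∀ {x} → U x → x ∈ F × x ∈ P₀) →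
                 v ∈ P₀ → v ~ r → r ∈ F → r ∉ P₀ → ⊥
    attachRoot {U} {v} {r} state U⊆ v∈ vr r∈F r∉P₀ = root r∈F r∉P₀
      (relax inj₂ id id (leafStep (refocus state v∈) r∉P₀ refl (~-sym vr) (λ u → ∈∉⊥ {P₀} (proj₂ (U⊆ u)) r∉P₀)))
      (λ { (inj₁ u) → proj₁ (U⊆ u) , insert-old {P₀} (proj₂ (U⊆ u)) ; (inj₂ refl) → r∈F , insert-self {P₀} })

    module Outside {U v y} (state : State P₀ (λ _ → ⊥) U (λ _ → ⊥)) (U⊆₀ : ∀ {x} → U x → x ∈ F × x ∈ P₀)
                   (v∈ : v ∈ P₀) (vy : v ~ y) (y∉F : y ∉ F) (y∉P₀ : y ∉ P₀)
                   {a b} (a≢b : a ≢ b) (ya : y ~ a) (yb : y ~ b)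
                   (p : Walk G a b) (pp : IsPath G p) (p⊆F : ∀ {x} → x ∈ᴸ vertices G p → x ∈ F) where

      reach-p : ∀ {x} → x ∈ᴸ vertices G p → Reach (_∈ F) a x
      reach-p m = reach-mono p⊆F (reach-vertex p m)

      unplaced : ∀ {x} → x ∈ᴸ vertices G p → x ∉ P₀
      unplaced {x} m with dec∈ P₀ x
      ... | inj₂ x∉ = x∉
      ... | inj₁ x∈ = ⊥-elim (noDouble₀ y∉F y∉P₀ a≢b ya yb (reach-p (last∈ p)) (closed-reach {F} {P₀} closed₀ (reach-sym (reach-p m)) x∈))

      P₁ : VSet
      P₁ = insert P₀ y

      st₁ : State P₁ (_≡ y) (U ⊕ a) (λ _ → ⊥)
      -- The edge `vy` takes the name `a`, which the ear starting at `a` will not need.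
      st₁ = relax inj₂ id id (leafStep (refocus state v∈) y∉P₀ refl (~-sym vy) (λ u → ∈∉⊥ {P₀} (proj₂ (U⊆₀ u)) (unplaced (head∈ p))))

      e : Ear P₁ (_≡ y) (U ⊕ a) (λ _ → ⊥) (_∈ᴸ vertices G p) a
      e = ear st₁ refl (~-sym ya) (~-sym yb) a≢b p pp
            (λ m → insert-∉ {P₀} (unplaced m) (λ { refl → ∈∉⊥ {F} (p⊆F m) y∉F }))
            (λ { m x≢a (inj₁ u) → ∈∉⊥ {P₀} (proj₂ (U⊆₀ u)) (unplaced m) ; m x≢a (inj₂ eq) → x≢a eq })

      open Ear e using (P″; C″; U″)

      pt : Partial P″ C″ U″ (λ _ → ⊥)
      pt = earPartial e (insert-⊏ {P₀} y∉P₀)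
             (λ { (xF , xP , x∉) → Sum.[ (λ x∈ → ⊥-elim (∈∉⊥ {P₀} x∈ x∉)) , id ]′ (insert-split {P₀} xP) })
             p⊆F (head∈ p)
             (λ { (inj₁ u) → proj₁ (U⊆₀ u) , inj₁ (insert-old {P₀} (proj₂ (U⊆₀ u))) ; (inj₂ refl) → p⊆F (head∈ p) , inj₂ refl })

      core-path : ∀ {x} → Core P″ x → x ∈ᴸ vertices G p
      core-path (xF , xP , x∉) with Ear.P″⊆ e xP
      ... | inj₂ m = m
      ... | inj₁ x∈ with insert-split {P₀} x∈
      ...   | inj₁ x∈₀ = ⊥-elim (∈∉⊥ {P₀} x∈₀ x∉)
      ...   | inj₂ refl = ⊥-elim (∈∉⊥ {F} xF y∉F)

      path-core : ∀ {x} → x ∈ᴸ vertices G p → Core P″ x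
      path-core m = p⊆F m , C⊆P (Ear.state e) (Ear.New⊆C″ e m) , unplaced m

      -- If the component has a vertex off the path, leaves can be hung until a last one ℓ remains.
      -- The hypothesis covers the other case, where all names are spent and the forest has to
      -- change.
      outsideSingle : ((∀ {z} → Reach (_∈ F) a z → z ∈ᴸ vertices G p) → ⊥) → ⊥
      outsideSingle whole = start pt
        (λ cx cy → reach-mono path-core (reach-sym (reach-vertex p (core-path cx)) ◅◅ reach-vertex p (core-path cy)))
        λ closed → whole λ {z} r → core-path (target r , closed-reach {F} {P″} closed r (proj₁ (proj₂ (path-core (head∈ p)))) , out r)
        where
        out : ∀ {z} → Reach (_∈ F) a z → z ∉ P₀
        out {z} r with dec∈ P₀ z
        ... | inj₂ z∉ = z∉
        ... | inj₁ z∈ = ⊥-elim (∈∉⊥ {P₀} (closed-reach {F} {P₀} closed₀ (reach-sym r) z∈) (unplaced (head∈ p)))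

      -- The name saved by the first ear pays for the edge `vy`; the name saved by a second ear at
      -- y, through another component, stays spare.
      outsideMulti : ∀ {a′ b′} → a′ ≢ b′ → y ~ a′ → y ~ b′ → Reach (_∈ F) a′ b′ → ¬ Reach (_∈ F) a a′ → ⊥
      outsideMulti {a′} {b′} a′≢b′ ya′ yb′ r apart =
        finishSpare (remaining (Ear.P″ e′)) pt′ (λ ()) (source r) (C⊆P (Ear.state e′) (Ear.New⊆C″ e′ (head∈ path))) spare ℕ.≤-refl
        where
        path′ = reach⇒path r
        path = proj₁ path′
        path⊆F : ∀ {x} → x ∈ᴸ vertices G path → x ∈ F
        path⊆F = All.lookup (proj₂ (proj₂ path′))
        unplaced′ : ∀ {x} → x ∈ᴸ vertices G path → x ∉ P″
        unplaced′ {x} m with dec∈ P″ x | dec∈ P₀ x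
        ... | inj₂ x∉ | _ = x∉
        ... | inj₁ x∈ | inj₂ x∉₀ = ⊥-elim (apart (reach-p (core-path (path⊆F m , x∈ , x∉₀)) ◅◅ reach-sym (reach-mono path⊆F (reach-vertex path m))))
        ... | inj₁ _ | inj₁ x∈₀ = ⊥-elim (noDouble₀ y∉F y∉P₀ a′≢b′ ya′ yb′ r
                (closed-reach {F} {P₀} closed₀ (reach-sym (reach-mono path⊆F (reach-vertex path m))) x∈₀))
        e′ : Ear P″ C″ U″ (λ _ → ⊥) (_∈ᴸ vertices G path) a′
        e′ = ear (st pt) (Ear.C⊆C″ e refl) (~-sym ya′) (~-sym yb′) a′≢b′ path (proj₁ (proj₂ path′)) unplaced′
               (λ m _ u → ∈∉⊥ {P″} (proj₂ (U⊆ pt u)) (unplaced′ m))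
        pt′ = earPartial e′ (grows pt) (core⊆C pt) path⊆F (head∈ path) (λ u → proj₁ (U⊆ pt u) , inj₁ (proj₂ (U⊆ pt u)))
        spare : ¬ Ear.U″ e′ a′
        spare u with Ear.U″⊆ e′ u
        ... | inj₁ u = ∈∉⊥ {P″} (proj₂ (U⊆ pt u)) (unplaced′ (head∈ path))
        ... | inj₂ (_ , ne) = ne refl

  -- Entering a component that is a single path

  -- Cutting the path at its first neighbour of y leaves y only that neighbour beyond the start, as
  -- the exchange of y for the start requires.
  firstNbr : ∀ {y x b} (p : Walk G x b) → y ~ b →
             ∃[ b′ ] Σ[ q ∈ Walk G x b′ ] (y ~ b′ × (IsPath G p → IsPath G q) ×
               (∀ {z} → z ∈ᴸ vertices G q → z ∈ᴸ vertices G p) × (∀ {z} → z ∈ᴸ vertices G q → y ~ z → z ≡ b′))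
  firstNbr stop yb = _ , stop , yb , id , id , λ { (here eq) _ → eq }
  firstNbr {y} {x} (step e p) yb with adj y x in eq
  ... | true = x , stop , ≡true⇒~ eq , (λ _ → [] ∷ []) , (λ { (here eq) → here eq }) , λ { (here eq) _ → eq }
  ... | false =
    let b′ , q , yb′ , path , sub , first = firstNbr p yb in
    b′ , step e q , yb′ , (λ { (d ∷ pp) → All.tabulate (λ m → All.lookup d (sub m)) ∷ path pp }) ,
    (λ { (here eq) → here eq ; (there m) → there (sub m) }) ,
    λ { (here refl) yz → ⊥-elim (subst T eq yz) ; (there m) yz → first m yz }

  -- If the component of a is just the path from a to b, then y can replace a in F.
  module Exchange {F P₀ : VSet} (ext : Extremal F) (closed₀ : Closed F P₀) (noDouble₀ : NoDouble F P₀)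
                  {y a w b} (y∉F : y ∉ F) (y∉P₀ : y ∉ P₀) (a∉P₀ : a ∉ P₀) (ya : y ~ a) (yb : y ~ b) (e : a ~ w)
                  (q : Walk G w b) (pp : IsPath G (step e q)) (p⊆F : ∀ {x} → x ∈ᴸ vertices G (step e q) → x ∈ F)
                  (first : ∀ {z} → z ∈ᴸ vertices G q → y ~ z → z ≡ b)
                  (whole : ∀ {z} → Reach (_∈ F) a z → z ∈ᴸ vertices G (step e q))
                  (single : ¬ (∃[ a′ ] ∃[ b′ ] (a′ ≢ b′ × y ~ a′ × y ~ b′ × Reach (_∈ F) a′ b′ × ¬ Reach (_∈ F) a a′))) where

    F₁ F′ : VSet
    F₁ = delete F a
    F′ = insert F₁ y

    a∈F : a ∈ F
    a∈F = p⊆F (here refl)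

    ∈q⇒≢a : ∀ {z} → z ∈ᴸ vertices G q → a ≢ z
    ∈q⇒≢a = All.lookup (AllPairs.head pp)

    whole-q : ∀ {z} → Reach (_∈ F) a z → z ≢ a → z ∈ᴸ vertices G q
    whole-q r z≢a with whole r
    ... | here eq = ⊥-elim (z≢a eq)
    ... | there m = m

    y∉F₁ : y ∉ F₁
    y∉F₁ = cong (_∧ not (y == a)) y∉F

    F₁⊆F : ∀ {x} → x ∈ F₁ → x ∈ F × x ≢ a
    F₁⊆F = delete-∈⁻ {F}

    nd : ¬ Double (_∈ F₁) y
    -- In the component of `a` both neighbours would be `b`; in another one they contradict
    -- `single`.
    nd (a′ , b′ , ne , ya′ , yb′ , r) = em
      (λ aa′ → ne (trans (first (whole-q aa′ (proj₂ (F₁⊆F (source r)))) ya′)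
                     (sym (first (whole-q (aa′ ◅◅ r′) (proj₂ (F₁⊆F (target r)))) yb′))))
      (λ apart → single (a′ , b′ , ne , ya′ , yb′ , r′ , apart))
      where r′ = reach-mono (proj₁ ∘ F₁⊆F) r

    -- The rest of the component is the path `q`, which connects all neighbours of `a` without `a`.
    a-leaf : deg F₁ a ≤ 1
    a-leaf = deg≤1 ext a∈F λ x∈ z∈ ax az _ → reach-mono (λ m → p⊆F (there m) , ∈q⇒≢a m)
      (reach-sym (reach-vertex q (nbr x∈ ax)) ◅◅ reach-vertex q (nbr z∈ az))
      where
      nbr : ∀ {x} → x ∈ F → a ~ x → x ∈ᴸ vertices G q
      nbr x∈ ax = whole-q (step a∈F ax (here x∈)) (~⇒≢ ax ∘ sym)

    b≢a : b ≢ a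
    b≢a = ∈q⇒≢a (last∈ q) ∘ sym

    b∈F : b ∈ F
    b∈F = p⊆F (there (last∈ q))

    nbr≡b : ∀ {x} → x ∈ F → x ≢ a → y ~ x → x ≡ b
    nbr≡b x∈ x≢a yx = swap-single ext a∈F y∉F nd a-leaf x∈ x≢a yx b∈F b≢a yb

    -- No edge is lost: `a` gives up at most one, and y brings the edge to `b`.
    ext′ : Extremal F′
    ext′ = record
      { acyclic = insert-acyclic {F₁} (delete-acyclic {F} (acyclic ext)) nd
      ; size = swap-size ext a∈F y∉F
      ; densest = λ S ac sz → ℕ.≤-trans (densest ext S ac sz) (subst₂ _≤_ (sym (edges-delete F a∈F)) (sym (edges-insert F₁ y∉F₁))
          (ℕ.+-monoʳ-≤ (edges F₁) (ℕ.+-mono-≤ deg≤ deg≤))) }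
      where
      b-nbr : nbrs F₁ y b ≡ true
      b-nbr rewrite delete-∈ {F} b∈F b≢a | ~⇒≡true yb = refl
      deg≤ : deg F₁ a ≤ deg F₁ y
      deg≤ = ℕ.≤-trans a-leaf (count≥1 (nbrs F₁ y) b-nbr)

    b∉P₀ : b ∉ P₀
    b∉P₀ with dec∈ P₀ b
    ... | inj₂ b∉ = b∉
    ... | inj₁ b∈ = ⊥-elim (∈∉⊥ {P₀} (closed-reach {F} {P₀} closed₀
            (reach-sym (reach-mono p⊆F (reach-vertex (step e q) (there (last∈ q))))) b∈) a∉P₀)

    F′∩P₀⊆F : ∀ {x} → x ∈ F′ → x ∈ P₀ → x ∈ F
    F′∩P₀⊆F x∈ x∈₀ with insert-split {F₁} x∈
    ... | inj₁ x∈₁ = proj₁ (F₁⊆F x∈₁)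
    ... | inj₂ refl = ⊥-elim (∈∉⊥ {P₀} x∈₀ y∉P₀)

    F∩P₀⊆F′ : ∀ {x} → x ∈ F → x ∈ P₀ → x ∈ F′
    F∩P₀⊆F′ x∈ x∈₀ = insert-old {F₁} (delete-∈ {F} x∈ (λ { refl → ∈∉⊥ {P₀} x∈₀ a∉P₀ }))

    -- The new vertex y might have touched placed forest vertices; by density its only neighbour
    -- left is `b`, which is unplaced.
    closed′ : Closed F′ P₀
    closed′ {x} {z} x∈ z∈ xz x∈₀ with insert-split {F₁} z∈
    ... | inj₁ z∈₁ = closed₀ (F′∩P₀⊆F x∈ x∈₀) (proj₁ (F₁⊆F z∈₁)) xz x∈₀
    ... | inj₂ refl = ⊥-elim (∈∉⊥ {P₀} x∈₀ (subst (_∉ P₀)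
            (sym (nbr≡b (F′∩P₀⊆F x∈ x∈₀) (λ { refl → ∈∉⊥ {P₀} x∈₀ a∉P₀ }) (~-sym xz))) b∉P₀))

    reach-back : ∀ {u v} → Reach (_∈ F′) u v → u ∈ P₀ → Reach (_∈ F) u v
    reach-back (here s) u∈₀ = here (F′∩P₀⊆F s u∈₀)
    reach-back (step s e r) u∈₀ = step (F′∩P₀⊆F s u∈₀) e (reach-back r (closed′ s (source r) e u∈₀))

    noDouble′ : NoDouble F′ P₀
    noDouble′ {z} {a′} z∉ z∉₀ ne za zb r a∈₀ with dec∈ F z
    ... | inj₂ z∉F = noDouble₀ z∉F z∉₀ ne za zb (reach-back r a∈₀) a∈₀
    ... | inj₁ z∈F = ∈∉⊥ {P₀} (closed₀ (F′∩P₀⊆F (source r) a∈₀) z∈F (~-sym za) a∈₀) z∉₀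

  -- Growth to the whole graph

  Next : VSet → Set₁
  Next P₀ = ∀ {F P} → Extremal F → Complete F P → P₀ ⊏ P → ⊥

  outside : ∀ {F P₀ v y} → Extremal F → Complete F P₀ → Next P₀ → v ∈ P₀ → v ~ y → y ∉ F → y ∉ P₀ → ⊥
  outside {F} {P₀} {v} {y} ext cs next v∈ vy y∉F y∉P₀ = outside-double ext y∉F λ (a , b , a≢b , ya , yb , r) →
    let p , pp , p⊆F = reach⇒path r in
    em (λ (a′ , b′ , ne , ya′ , yb′ , r′ , apart) →
          Here.Outside.outsideMulti state U⊆ v∈ vy y∉F y∉P₀ a≢b ya yb p pp (All.lookup p⊆F) ne ya′ yb′ r′ apart)
       (λ single → go a≢b ya yb p pp (All.lookup p⊆F) single)
    where
    open Complete cs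
    module Here = Block F P₀ ext closed noDouble (next ext)
    go : ∀ {a b} → a ≢ b → y ~ a → y ~ b → (p : Walk G a b) → IsPath G p → (∀ {x} → x ∈ᴸ vertices G p → x ∈ F) →
         ¬ (∃[ a′ ] ∃[ b′ ] (a′ ≢ b′ × y ~ a′ × y ~ b′ × Reach (_∈ F) a′ b′ × ¬ Reach (_∈ F) a a′)) → ⊥
    go a≢b ya yb stop _ _ _ = a≢b refl
    go {a} a≢b ya yb (step e p) (d ∷ pp) p⊆F single with firstNbr p yb
    ... | b′ , q , yb′ , path , sub , first = O.outsideSingle exchange
      where
      pq : IsPath G (step e q)
      pq = All.tabulate (λ m → All.lookup d (sub m)) ∷ path pp
      q⊆F : ∀ {x} → x ∈ᴸ vertices G (step e q) → x ∈ F
      q⊆F (here eq) = p⊆F (here eq)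
      q⊆F (there m) = p⊆F (there (sub m))
      module O = Here.Outside state U⊆ v∈ vy y∉F y∉P₀ (All.lookup d (sub (last∈ q))) ya yb′ (step e q) pq q⊆F
      exchange : (∀ {z} → Reach (_∈ F) a z → z ∈ᴸ vertices G (step e q)) → ⊥
      -- In the new forest y is a forest vertex adjacent to the placed `v`, so its own name can
      -- colour `vy`.
      exchange whole = Block.attachRoot X.F′ P₀ X.ext′ X.closed′ X.noDouble′ (next X.ext′) state
             (λ u → X.F∩P₀⊆F′ (proj₁ (U⊆ u)) (proj₂ (U⊆ u)) , proj₂ (U⊆ u)) v∈ vy (insert-self {X.F₁}) y∉P₀
        where
        module X = Exchange ext closed noDouble y∉F y∉P₀ (O.unplaced (here refl)) ya yb′ e q pq q⊆F first whole single

  crossing : ∀ {P u v} → Walk G u v → u ∈ P → v ∉ P → ∃[ x ] ∃[ y ] (x ∈ P × y ∉ P × x ~ y)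
  crossing {P} stop u∈ u∉ = ⊥-elim (∈∉⊥ {P} u∈ u∉)
  crossing {P} (step {w = w} e p) u∈ v∉ with dec∈ P w
  ... | inj₁ w∈ = crossing p w∈ v∉
  ... | inj₂ w∉ = _ , w , u∈ , w∉ , e

  module _ (connected : Connected G) (impossible : RainbowConnectable G (f + 2) → ⊥) where
    open Finish G

    grow : ∀ k {F P x} → Extremal F → Complete F P → x ∈ P → remaining P ≤ k → ⊥
    grow k {F} {P} {x} ext cs x∈ bound = em
      (λ (z , z∉) → let v , u , v∈ , u∉ , vu = crossing {P} (connected x z) x∈ z∉ in extend k bound v∈ u∉ vu)
      (λ none → impossible (subst (λ k → RainbowConnectable G (k + 2)) (size ext)
                  (rainbow F state (λ y → Sum.[ id , (λ y∉ → ⊥-elim (none (y , y∉))) ]′ (dec∈ P y)) (proj₁ ∘ U⊆))))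
      where
      open Complete cs
      extend : ∀ k → remaining P ≤ k → ∀ {v u} → v ∈ P → u ∉ P → v ~ u → ⊥
      extend zero bound {u = u} _ u∉ _ = ℕ.<⇒≱ (count≥1 (not ∘ P) {u} (cong not u∉)) bound
      extend (suc k) bound {v} {u} v∈ u∉ vu = Sum.[
          (λ u∈F → Block.attachRoot F P ext closed noDouble (next ext) state U⊆ v∈ vu u∈F u∉) ,
          (λ u∉F → outside ext cs next v∈ vu u∉F u∉) ]′ (dec∈ F u)
        where
        next : Next P
        next ext′ cs′ P⊏ = grow k ext′ cs′ (proj₁ P⊏ x∈) (ℕ.≤-pred (ℕ.≤-trans (remaining-⊏ P⊏) bound))

    fromRoot : ∀ {F r} → Extremal F → r ∈ F → ⊥
    fromRoot {F} {r} ext r∈F = Block.root F (λ _ → false) ext (λ _ _ _ ()) (λ _ _ _ _ _ _ ())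
      (λ cs gr → grow _ ext cs (proj₁ (proj₂ (proj₂ gr))) ℕ.≤-refl) {U = λ _ → ⊥} r∈F refl
      (record { col = λ _ _ → inj₂ true ; col-sym = λ _ _ → refl ; C⊆P = λ { refl → ==-refl r }
              ; connP = λ p q → single p q ; connC = λ { refl refl → nil (==-refl r) } }) (λ ())
      where
      single : ∀ {x y} → x ∈ (_== r) → y ∈ (_== r) → RW (λ _ _ → inj₂ true) (_== r) (Good (λ _ → ⊥) Any) x y
      single {x} {y} p q with ==-true {i = x} {r} p | ==-true {i = y} {r} q
      ... | refl | refl = nil p

    -- A densest forest is found by climbing: `k` bounds the remaining increases of `edges`.
    fromForest : ∀ k {F} → ¬ Cyclic (_∈ F) → count F ≡ f → n * n ≤ edges F + k → V → ⊥
    fromForest k {F} ac sz bound z = em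
      (λ (S , ac′ , sz′ , more) → improve k bound ac′ sz′ more)
      (λ best → let ext = record { acyclic = ac ; size = sz
                                 ; densest = λ S ac′ sz′ → ℕ.≮⇒≥ (λ more → best (S , ac′ , sz′ , more)) }
                in Sum.[ fromRoot ext , (λ z∉ → outside-double ext z∉ λ (a , b , _ , _ , _ , r) → fromRoot ext (source r)) ]′ (dec∈ F z))
      where
      improve : ∀ k → n * n ≤ edges F + k → ∀ {S} → ¬ Cyclic (_∈ S) → count S ≡ f → edges F < edges S → ⊥
      improve zero bound {S} _ _ more = ℕ.<⇒≱ more (ℕ.≤-trans (edges≤ S) (subst (n * n ≤_) (ℕ.+-identityʳ _) bound))
      improve (suc k) bound {S} ac′ sz′ more = fromForest k ac′ sz′
        (ℕ.≤-trans bound (ℕ.≤-trans (ℕ.≤-reflexive (ℕ.+-suc (edges F) k)) (ℕ.+-monoˡ-≤ k more))) z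

theorem1 : (G : Graph) → Connected G → (f r : ℕ) → IsForestNumber G f → IsRc G r →
    r ≤ f + 2
theorem1 G connected f r ((S , forest , ∣S∣≡f) , maximum) (_ , least) =
  decidable-stable (r ℕ.≤? f + 2) λ r≰ → em
    (Main.fromForest G f maxf connected (r≰ ∘ least _) (n * n) {lookup S}
      (λ (u , w , e , p , pp , l , all) → forest (u , w , e , p , pp , l , All.map (Vec.lookup⇒[]= _ S) all))
      (trans (sym (∣tabulate∣ (lookup S))) (trans (cong ∣_∣ (Vec.tabulate∘lookup S)) ∣S∣≡f))
      (ℕ.m≤n+m (n * n) _))
    -- The graph without vertices has no root to start from, and any colouring does.
    (λ empty → r≰ (least _ (record { col = λ u _ → ⊥-elim (empty u) ; col-sym = λ u _ → ⊥-elim (empty u) } , λ u _ → ⊥-elim (empty u))))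
  where
  open Graph G using (n)
  maxf : ∀ S → ¬ Walks.Cyclic G (λ v → S v ≡ true) → count S ≤ f
  maxf S ac = subst (_≤ f) (∣tabulate∣ S) (maximum (tabulate S) λ (u , w , e , p , pp , l , all) →
    ac (u , w , e , p , pp , l , All.map (λ {x} m → trans (sym (Vec.lookup∘tabulate S x)) (Vec.[]=⇒lookup m)) all))
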